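{- Let $G$ be a 3-connected plane graph with auxiliary graph $G^\nabla$. For every minimal cut $R$ of $G$, there exists a unique minimal cut $S$ of $G^\nabla$ such that $S\cap V(G)=R$.
   Context: A large face of a 2-connected plane graph is a face whose bounding cycle has length at least 4. The auxiliary graph $G^\nabla$ is obtained from $G$ by adding, for each large face $W$, a new vertex placed inside $W$ and joined to every vertex of $W$. A cut of a connected graph $H=(V,E)$ is a set $S\subset V$ with $H-S$ disconnected; it is minimal if $H-T$ is connected for every proper subset $T\subset S$. -}

module Defs where

open import Data.Nat using (ℕ; zero; suc; _+_; _*_; _≤_; _<_)
import Data.Nat.Properties as ℕP
open import Data.Fin using (Fin; toℕ; splitAt; _≟_)
open import Data.Fin.Subset using (Subset; _∈_; _∉_; _⊆_; _⊂_; ∣_∣; ⊤; inside; outside)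
open import Data.Vec using (Vec; tabulate; take)
open import Data.List using (List; length; filter; allFin; upTo)
open import Data.List.Relation.Unary.All using (All; all?)
open import Data.Product using (Σ; ∃; ∃-syntax; _×_; _,_)
open import Data.Sum using (_⊎_; inj₁; inj₂)
open import Data.Bool using (Bool; true; false; _∧_; not; if_then_else_)
open import Data.Empty using (⊥)
open import Relation.Nullary using (¬_; Dec; does)
open import Relation.Binary.PropositionalEquality using (_≡_; _≢_)
open import Function.Definitions using (Injective)

iter : {A : Set} → (A → A) → ℕ → A → A
iter f zero    x = x
iter f (suc k) x = f (iter f k x)

-- Orbits of a permutation φ of Fin d.
-- x is the representative of its orbit iff it is the least element
-- (w.r.t. toℕ) of the orbit; orbits have size ≤ d, so iterates
-- φ^0 x, …, φ^(d-1) x cover the whole orbit.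

IsOrbitRep : {d : ℕ} → (Fin d → Fin d) → Fin d → Set
IsOrbitRep {d} φ x = All (λ k → toℕ x ≤ toℕ (iter φ k x)) (upTo d)

isOrbitRep? : {d : ℕ} (φ : Fin d → Fin d) (x : Fin d) → Dec (IsOrbitRep φ x)
isOrbitRep? {d} φ x = all? (λ k → toℕ x ℕP.≤? toℕ (iter φ k x)) (upTo d)

orbitCount : (d : ℕ) → (Fin d → Fin d) → ℕ
orbitCount d φ = length (filter (isOrbitRep? φ) (allFin d))

-- Plane graphs, given combinatorially as genus-0 combinatorial maps
-- (rotation systems).  Darts are Fin d; α is the fixed-point-free
-- involution pairing the two darts of an edge; σ is the rotation
-- (cyclic order of darts around their common tail vertex); faces are
-- the orbits of φ = σ ∘ α.  Planarity (genus 0) is Euler's formula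
-- n − d/2 + #faces = 2, written as 2 (n + #faces) = 4 + d.
-- The underlying graph is simple (no loops, no parallel edges).

record PlaneGraph : Set where
  field
    n d      : ℕ
    α σ      : Fin d → Fin d
    vert     : Fin d → Fin n                  -- tail vertex of a dart
    α-invol  : ∀ x → α (α x) ≡ x
    α-nofix  : ∀ x → α x ≢ x
    σ-inj    : Injective _≡_ _≡_ σ
    vert-σ   : ∀ x → vert (σ x) ≡ vert x
    σ-cyclic : ∀ x y → vert x ≡ vert y → ∃[ k ] iter σ k x ≡ y
    vert-surj : ∀ v → ∃[ x ] vert x ≡ v
    no-loop  : ∀ x → vert (α x) ≢ vert x
    no-multi : ∀ x y → vert x ≡ vert y → vert (α x) ≡ vert (α y) → x ≡ y
    euler    : 2 * (n + orbitCount d (λ x → σ (α x))) ≡ 4 + d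

  φ : Fin d → Fin d
  φ x = σ (α x)

record Graph : Set₁ where
  field
    N   : ℕ
    V   : Subset N
    Adj : Fin N → Fin N → Set

module _ (H : Graph) where
  open Graph H

  InMinus : Subset N → Fin N → Set
  InMinus S w = w ∈ V × w ∉ S

  data Walk (P : Fin N → Set) : Fin N → Fin N → Set where
    here : ∀ {u} → Walk P u u
    step : ∀ {u w v} → Adj u w → P w → Walk P w v → Walk P u v

  ConnectedMinus : Subset N → Set
  ConnectedMinus S = ∀ u v → InMinus S u → InMinus S v → Walk (InMinus S) u v

  IsCut : Subset N → Set
  IsCut S = S ⊆ V × ¬ ConnectedMinus S

  IsMinimalCut : Subset N → Set
  IsMinimalCut S = IsCut S × (∀ T → T ⊂ S → ConnectedMinus T)

  -- k-connected (Diestel): more than k vertices and H − X connected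
  -- for every X ⊆ V(H) with |X| < k
  KConnected : ℕ → Set
  KConnected k = k < ∣ V ∣ × (∀ X → X ⊆ V → ∣ X ∣ < k → ConnectedMinus X)

module _ (G : PlaneGraph) where
  open PlaneGraph G

  AdjG : Fin n → Fin n → Set
  AdjG u v = ∃[ x ] (vert x ≡ u × vert (α x) ≡ v)

  graphOf : Graph
  graphOf = record { N = n ; V = ⊤ ; Adj = AdjG }

  -- a face (φ-orbit of dart x) is large iff its bounding walk has
  -- length ≥ 4, i.e. φ^k x ≢ x for k = 1, 2, 3
  IsLarge : Fin d → Set
  IsLarge x = iter φ 1 x ≢ x × iter φ 2 x ≢ x × iter φ 3 x ≢ x

  isLarge : Fin d → Bool
  isLarge x = not (does (iter φ 1 x ≟ x)) ∧ not (does (iter φ 2 x ≟ x))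
              ∧ not (does (iter φ 3 x ≟ x))

  OnFace : Fin n → Fin d → Set
  OnFace v x = ∃[ k ] vert (iter φ k x) ≡ v

  -- G^∇ has vertex set Fin (n + d): the first n are V(G); vertex n + x
  -- is present iff x is the representative dart of a large face, and
  -- then it is the new vertex placed inside that face.
  nablaV : Subset (n + d)
  nablaV = tabulate λ i → helper (splitAt n i)
    where
    helper : Fin n ⊎ Fin d → Bool
    helper (inj₁ _) = inside
    helper (inj₂ x) = if does (isOrbitRep? φ x) ∧ isLarge x then inside else outside

  nablaAdj' : Fin n ⊎ Fin d → Fin n ⊎ Fin d → Set
  nablaAdj' (inj₁ u) (inj₁ v) = AdjG u v
  nablaAdj' (inj₁ u) (inj₂ x) = OnFace u x
  nablaAdj' (inj₂ x) (inj₁ u) = OnFace u x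
  nablaAdj' (inj₂ _) (inj₂ _) = ⊥

  nabla : Graph
  nabla = record { N = n + d ; V = nablaV
                 ; Adj = λ i j → nablaAdj' (splitAt n i) (splitAt n j) }

{-# OPTIONS --safe #-}
module Submission where

open import Defs
open import Data.Fin.Subset using (Subset)
open import Data.Vec using (take)
open import Data.Product using (∃-syntax; _×_)
open import Relation.Binary.PropositionalEquality using (_≡_)

-- Planarity enters through two facts about a minimal cut R of G: G − R has only
-- two components A and C, and no three consecutive vertices of a face all lie in R.
-- Hence, in a minimal cut S of G^∇ with trace R, the vertex of a large face belongs
-- to S exactly when the face meets both A and C.
--
-- Both facts are instances of K₃,₃ being nonplanar.  Three vertices of R are all
-- joined to A, to C and to a third connected thing (another component, or the
-- face), and two of them see these three in the same rotational order.  A cycle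
-- through these two vertices, A and C then has the third thing on both of its
-- sides.  That it has two sides follows from Euler's formula: extend the cycle to
-- a connected spanning subgraph with n edges; the remaining d/2 − n edges are too
-- few to connect the dual graph, and the resulting 2-colouring of the faces can
-- only change across the cycle.

open import Data.Bool using (Bool; true; false; _∧_)
import Data.Bool.Properties as 𝔹
open import Data.Empty using (⊥; ⊥-elim)
open import Data.Fin as Fin using (Fin; zero; suc; toℕ; fromℕ<; splitAt; _≟_; _↑ˡ_; _↑ʳ_)
import Data.Fin.Properties as Fin
open import Data.Fin.Subset using (∣_∣; inside; outside; ⊤; _∈_; _∉_; _⊆_; _⊂_; _-_; ⁅_⁆)
  renaming (⊥ to ∅)
import Data.Fin.Subset.Properties as Subset
open import Data.List as List using (List; []; _∷_; map; filter; length; allFin; upTo)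
open import Data.List.Properties using (length-map; length-++; filter-notAll; length-tabulate)
open import Data.List.Membership.Propositional using () renaming (_∈_ to _∈ˡ_)
open import Data.List.Membership.Propositional.Properties
open import Data.List.Relation.Unary.All as All using (All; _∷_)
open import Data.List.Relation.Unary.All.Properties using (¬All⇒Any¬)
open import Data.List.Relation.Unary.AllPairs using (_∷_)
open import Data.List.Relation.Unary.Any as Any using (here; there)
open import Data.List.Relation.Unary.Unique.Propositional using (Unique)
import Data.List.Relation.Unary.Unique.Propositional.Properties as Unique
open import Data.Nat using (ℕ; zero; suc; _+_; _*_; _∸_; _⊔_; _≤_; _<_; z≤n; s≤s; s≤s⁻¹)
open import Data.Nat.Induction using (<-rec)
import Data.Nat.Properties as ℕ
open import Data.Nat.Tactic.RingSolver using (solve-∀)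
open import Data.Product using (Σ; ∃; ∃₂; _,_; proj₁; proj₂)
open import Data.Sum as Sum using (_⊎_; inj₁; inj₂; [_,_]′)
open import Data.Vec using (_∷_; _++_; tabulate; lookup; drop; here; there)
open import Data.Vec.Properties using
  (lookup∘tabulate; lookup⇒[]=; []=⇒lookup; lookup-++ˡ; lookup-++ʳ; ++-injectiveˡ; take++drop≡id)
open import Function using (_∘_; id; case_of_)
open import Function.Definitions using (Injective)
open import Relation.Binary using (tri<; tri≈; tri>)
open import Relation.Binary.PropositionalEquality
open import Relation.Nullary using (¬_; Dec; yes; no; contradiction; does)
open import Relation.Nullary.Decidable using
  (¬?; _×-dec_; _⊎-dec_; decidable-stable; map′; dec-true)

-- Iterates and orbits of injections on a finite set.

iter-+ : {A : Set} (f : A → A) (j k : ℕ) (x : A) → iter f (j + k) x ≡ iter f j (iter f k x)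
iter-+ f zero    k x = refl
iter-+ f (suc j) k x = cong f (iter-+ f j k x)

iter-suc : {A : Set} (f : A → A) (k : ℕ) (x : A) → iter f (suc k) x ≡ iter f k (f x)
iter-suc f zero    x = refl
iter-suc f (suc k) x = cong f (iter-suc f k x)

iter-injective : {A : Set} {f : A → A} → Injective _≡_ _≡_ f → ∀ k → Injective _≡_ _≡_ (iter f k)
iter-injective f-inj zero    eq = eq
iter-injective f-inj (suc k) eq = iter-injective f-inj k (f-inj eq)

module _ {m : ℕ} {f : Fin m → Fin m} (f-inj : Injective _≡_ _≡_ f) where

  -- Two of the first `m + 1` iterates coincide, and injectivity cancels the shorter one, which
  -- leaves a period `suc q` of at most `m`.
  iter-periodic : ∀ x → ∃[ q ] q < m × iter f (suc q) x ≡ x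
  iter-periodic x with Fin.pigeonhole (ℕ.n<1+n m) (λ i → iter f (toℕ i) x)
  ... | i , j , i<j , eq = q , q<m , iter-injective f-inj (toℕ i) (begin
      iter f (toℕ i) (iter f (suc q) x) ≡⟨ iter-+ f (toℕ i) (suc q) x ⟨
      iter f (toℕ i + suc q) x          ≡⟨ cong (λ k → iter f k x) i+q≡j ⟩
      iter f (toℕ j) x                  ≡⟨ eq ⟨
      iter f (toℕ i) x                  ∎)
    where
    open ≡-Reasoning
    q : ℕ
    q = toℕ j ∸ suc (toℕ i)
    i+q≡j : toℕ i + suc q ≡ toℕ j
    i+q≡j = trans (ℕ.+-suc (toℕ i) q) (ℕ.m+[n∸m]≡n i<j)
    q<m : q < m
    q<m = ℕ.≤-trans (ℕ.≤-trans (ℕ.m≤n+m (suc q) (toℕ i)) (ℕ.≤-reflexive i+q≡j)) (s≤s⁻¹ (Fin.toℕ<n j))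

  -- Steps are counted modulo the period, so tests over the iterates below `m` speak about whole
  -- orbits.
  iter-reduce : ∀ x k → ∃[ j ] j < m × iter f j x ≡ iter f k x
  iter-reduce x k with iter-periodic x
  ... | q , q<m , per = let j , j≤q , eq = go k in j , ℕ.≤-<-trans j≤q q<m , eq
    where
    go : ∀ k → ∃[ j ] j ≤ q × iter f j x ≡ iter f k x
    go zero    = 0 , z≤n , refl
    go (suc k) with go k
    ... | j , j≤q , eq with ℕ.m≤n⇒m<n∨m≡n j≤q
    ...   | inj₁ j<q  = suc j , j<q , cong f eq
    ...   | inj₂ refl = 0 , z≤n , trans (sym per) (cong f eq)

  iter-sym : ∀ {x y} k → iter f k x ≡ y → ∃[ j ] iter f j y ≡ x
  iter-sym zero refl = 0 , refl
  iter-sym {x} (suc k) refl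
    with iter-sym k refl | iter-periodic (iter f k x)
  -- `suc q` is a period of `iter f k x`, so `q` steps undo the last application of `f`, and `j`
  -- more lead back to `x`.
  ... | j , eq | q , _ , per = j + q , (begin
    iter f (j + q) (f (iter f k x))        ≡⟨ iter-+ f j q _ ⟩
    iter f j (iter f q (f (iter f k x)))   ≡⟨ cong (iter f j) (iter-suc f q _) ⟨
    iter f j (iter f (suc q) (iter f k x)) ≡⟨ cong (iter f j) per ⟩
    iter f j (iter f k x)                  ≡⟨ eq ⟩
    x                                      ∎)
    where open ≡-Reasoning

  SameOrbit : Fin m → Fin m → Set
  SameOrbit x y = ∃[ k ] iter f k x ≡ y

  SameOrbit-trans : ∀ {x y z} → SameOrbit x y → SameOrbit y z → SameOrbit x z
  SameOrbit-trans (j , refl) (k , refl) = k + j , iter-+ f k j _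

  orbitRep-unique : ∀ {x y} → IsOrbitRep f x → IsOrbitRep f y → SameOrbit x y → x ≡ y
  orbitRep-unique {x} {y} x-rep y-rep (k , eq) =
    Fin.toℕ-injective (ℕ.≤-antisym (least x-rep (k , eq)) (least y-rep (iter-sym k eq)))
    where
    least : ∀ {x y} → IsOrbitRep f x → SameOrbit x y → toℕ x ≤ toℕ y
    least {x} rep (k , refl) with iter-reduce x k
    ... | j , j<m , eq′ = subst (λ z → toℕ x ≤ toℕ z) eq′ (All.lookup rep (∈-upTo⁺ j<m))

  orbitRep-exists : ∀ x → ∃[ r ] IsOrbitRep f r × SameOrbit x r
  orbitRep-exists x = <-rec P below (toℕ x) x refl
    where
    P : ℕ → Set
    P t = ∀ x → toℕ x ≡ t → ∃[ r ] IsOrbitRep f r × SameOrbit x r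
    below : ∀ t → (∀ {s} → s < t → P s) → P t
    below t rec x refl with isOrbitRep? f x
    ... | yes rep = x , rep , 0 , refl
    ... | no ¬rep with Any.satisfied (¬All⇒Any¬ (λ k → toℕ x ℕ.≤? toℕ (iter f k x)) (upTo m) ¬rep)
    ...   | k , x≰ with rec (ℕ.≰⇒> x≰) (iter f k x) refl
    ...     | r , rep , same = r , rep , SameOrbit-trans (k , refl) same

  -- With `φ` for `f`, this names the face of a dart.
  rep : Fin m → Fin m
  rep x = proj₁ (orbitRep-exists x)

  rep-f : ∀ x → rep (f x) ≡ rep x
  rep-f x with orbitRep-exists x | orbitRep-exists (f x)
  ... | r , r-rep , x~r | s , s-rep , fx~s =
    orbitRep-unique s-rep r-rep
      (SameOrbit-trans (iter-sym (proj₁ fx~s) (proj₂ fx~s)) (SameOrbit-trans (iter-sym 1 refl) x~r))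

  rep-id : ∀ {r} → IsOrbitRep f r → rep r ≡ r
  rep-id {r} r-rep with orbitRep-exists r
  ... | s , s-rep , r~s = sym (orbitRep-unique r-rep s-rep r~s)

-- Disconnecting a graph that has few edges.

module _ {m : ℕ} where

  without : Fin m → List (Fin m) → List (Fin m)
  without b = filter (λ x → ¬? (x ≟ b))

  ∈-without : ∀ {b x xs} → x ∈ˡ xs → x ≢ b → x ∈ˡ without b xs
  ∈-without = ∈-filter⁺ (λ x → ¬? (x ≟ _))

  -- Each entry of `xs` cancels its copies in `ys`; the later entries differ from it, so they
  -- survive the removal.
  unique-⊆⇒length≤ : ∀ {xs ys : List (Fin m)} → Unique xs → (∀ {x} → x ∈ˡ xs → x ∈ˡ ys) →
                     length xs ≤ length ys
  unique-⊆⇒length≤ {[]} _ _ = z≤n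
  unique-⊆⇒length≤ {x ∷ xs} {ys} (x∉xs ∷ uniq) xs⊆ys = ℕ.≤-<-trans
    (unique-⊆⇒length≤ uniq λ y∈xs →
      ∈-without (xs⊆ys (there y∈xs)) (≢-sym (All.lookup x∉xs y∈xs)))
    (filter-notAll (λ y → ¬? (y ≟ x)) ys (Any.map (λ eq ¬eq → ¬eq (sym eq)) (xs⊆ys (here refl))))

  length-without : ∀ b {xs} → Unique xs → length xs ≤ suc (length (without b xs))
  length-without b {xs} uniq = unique-⊆⇒length≤ {ys = b ∷ without b xs} uniq λ {x} x∈xs →
    case x ≟ b of λ { (yes x≡b) → here x≡b ; (no x≢b) → there (∈-without x∈xs x≢b) }

  -- A graph with k edges on at least k + 2 vertices is disconnected: identify
  -- the two ends of one edge and induct.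
  twoColour : ∀ k (es : List (Fin m × Fin m)) (xs : List (Fin m)) →
    length es ≡ k → Unique xs → 2 + k ≤ length xs →
    Σ (Fin m → Bool) λ g → (∀ {a b} → (a , b) ∈ˡ es → g a ≡ g b) ×
      ∃₂ λ u v → u ∈ˡ xs × v ∈ˡ xs × g u ≢ g v
  twoColour zero [] (u ∷ v ∷ _) _ ((u≢v ∷ _) ∷ _) _ =
    (λ x → does (x ≟ u)) , (λ ()) , u , v , here refl , there (here refl) , differ
    where
    differ : does (u ≟ u) ≢ does (v ≟ u)
    differ eq with u ≟ u | v ≟ u
    ... | no u≢u | _ = u≢u refl
    ... | yes _  | yes v≡u = u≢v (sym v≡u)
    ... | yes _  | no _ = case eq of λ ()
  twoColour zero [] (_ ∷ []) _ _ (s≤s ())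
  twoColour (suc k) ((a , b) ∷ es) xs es≡k uniq len =
    let g , g-es , u , v , u∈ , v∈ , gu≢gv = twoColour k (map s₂ es) (without b xs)
          (trans (length-map s₂ es) (ℕ.suc-injective es≡k))
          (Unique.filter⁺ _ uniq)
          (s≤s⁻¹ (ℕ.≤-trans len (length-without b uniq)))
        u∈xs , u≢b = ∈-filter⁻ (λ x → ¬? (x ≟ b)) u∈
        v∈xs , v≢b = ∈-filter⁻ (λ x → ¬? (x ≟ b)) v∈
    in g ∘ s
     , (λ { (here refl) → cong g (trans s-a (sym s-b)) ; (there e∈) → g-es (∈-map⁺ s₂ e∈) })
     , u , v , u∈xs , v∈xs
     , λ eq → gu≢gv (trans (cong g (sym (s-≢ u≢b))) (trans eq (cong g (s-≢ v≢b))))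
    where
    s : Fin m → Fin m
    s x with x ≟ b
    ... | yes _ = a
    ... | no _  = x
    s₂ : Fin m × Fin m → Fin m × Fin m
    s₂ (x , y) = s x , s y
    s-a : s a ≡ a
    s-a with a ≟ b
    ... | yes _ = refl
    ... | no _  = refl
    s-b : s b ≡ a
    s-b with b ≟ b
    ... | yes _   = refl
    ... | no b≢b = contradiction refl b≢b
    s-≢ : ∀ {x} → x ≢ b → s x ≡ x
    s-≢ {x} x≢b with x ≟ b
    ... | yes x≡b = contradiction x≡b x≢b
    ... | no _    = refl

-- Lets equality of colours be proved by contradiction, without deciding whether an edge is chosen
-- or a vertex lies on the cycle.
bool-stable : ∀ {a b : Bool} → ¬ ¬ (a ≡ b) → a ≡ b
bool-stable {a} {b} = decidable-stable (a 𝔹.≟ b)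

-- Euler's formula and colourings of the faces.

module _ (G : PlaneGraph) where
  open PlaneGraph G

  head : Fin d → Fin n
  head x = vert (α x)

  α-injective : Injective _≡_ _≡_ α
  α-injective {x} {y} eq = trans (sym (α-invol x)) (trans (cong α eq) (α-invol y))

  φ-injective : Injective _≡_ _≡_ φ
  φ-injective = α-injective ∘ σ-inj

  -- The n edges of p leave d/2 − n others.  By Euler's formula this is two less
  -- than the number of faces, so these edges do not connect the dual graph.
  jordan : (p : Fin n → Fin d) → (∀ v → vert (p v) ≡ v) → (∀ v w → p v ≢ α (p w)) →
    Σ (Fin d → Bool) λ g → (∀ x → g (φ x) ≡ g x) ×
      (∀ x → (∀ v → x ≢ p v) → (∀ v → x ≢ α (p v)) → g x ≡ g (α x)) ×
      ∃₂ λ x y → g x ≢ g y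
  jordan p p-vert p-noback =
    let g , g-es , u , v , u∈ , v∈ , gu≢gv =
          twoColour (length kept) (map sides kept) reps (length-map sides kept)
            (Unique.filter⁺ (isOrbitRep? φ) (Unique.allFin⁺ d)) enough
        _ , u-rep = ∈-filter⁻ (isOrbitRep? φ) {xs = allFin d} u∈
        _ , v-rep = ∈-filter⁻ (isOrbitRep? φ) {xs = allFin d} v∈
    in g ∘ face , cong g ∘ rep-f φ-injective , across g g-es , u , v
     , λ eq → gu≢gv (trans (cong g (sym (rep-id φ-injective u-rep)))
                      (trans eq (cong g (rep-id φ-injective v-rep))))
    where
    face : Fin d → Fin d
    face = rep φ-injective
    sides : Fin d → Fin d × Fin d
    sides x = face x , face (α x)
    -- The comparison selects one dart of each edge, so that edges are counted once.
    Kept : Fin d → Set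
    Kept x = toℕ x < toℕ (α x) × (∀ v → x ≢ p v) × (∀ v → x ≢ α (p v))
    kept? : ∀ x → Dec (Kept x)
    kept? x = (toℕ x ℕ.<? toℕ (α x)) ×-dec Fin.all? (λ v → ¬? (x ≟ p v))
                                     ×-dec Fin.all? (λ v → ¬? (x ≟ α (p v)))
    kept reps all : List (Fin d)
    kept = filter kept? (allFin d)
    reps = filter (isOrbitRep? φ) (allFin d)
    -- Both darts of every kept edge and of every chosen edge. They are pairwise distinct, so twice
    -- `length kept + n` is at most `d`; Euler's formula turns this into `enough`.
    all  = kept List.++ map α kept List.++ map p (allFin n) List.++ map (α ∘ p) (allFin n)

    isKept : ∀ {x} → x ∈ˡ kept → Kept x
    isKept = proj₂ ∘ ∈-filter⁻ kept? {xs = allFin d}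

    p-injective : ∀ {v w} → p v ≡ p w → v ≡ w
    p-injective {v} {w} eq = trans (sym (p-vert v)) (trans (cong vert eq) (p-vert w))

    all-unique : Unique all
    all-unique =
      Unique.++⁺ (Unique.filter⁺ kept? (Unique.allFin⁺ d))
        (Unique.++⁺ (Unique.map⁺ α-injective (Unique.filter⁺ kept? (Unique.allFin⁺ d)))
          (Unique.++⁺ (Unique.map⁺ p-injective (Unique.allFin⁺ n))
            (Unique.map⁺ (p-injective ∘ α-injective) (Unique.allFin⁺ n))
            λ (x∈ , x∈′) → p∉αp (∈-map⁻ p x∈) (∈-map⁻ (α ∘ p) x∈′))
          λ (x∈ , x∈′) → αkept∉p (∈-map⁻ α x∈) (∈-++⁻ (map p (allFin n)) x∈′))
        λ (x∈ , x∈′) → kept∉rest (isKept x∈) (∈-++⁻ (map α kept) x∈′)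
      where
      p∉αp : ∀ {x} → ∃[ v ] v ∈ˡ allFin n × x ≡ p v → ¬ (∃[ v ] v ∈ˡ allFin n × x ≡ α (p v))
      p∉αp (v , _ , eq) (w , _ , eq′) = p-noback v w (trans (sym eq) eq′)
      αkept∉p : ∀ {x} → ∃[ y ] y ∈ˡ kept × x ≡ α y →
        ¬ (x ∈ˡ map p (allFin n) ⊎ x ∈ˡ map (α ∘ p) (allFin n))
      αkept∉p (y , y∈ , refl) (inj₁ x∈) with ∈-map⁻ p x∈
      ... | v , _ , eq = proj₂ (proj₂ (isKept y∈)) v (trans (sym (α-invol y)) (cong α eq))
      αkept∉p (y , y∈ , refl) (inj₂ x∈) with ∈-map⁻ (α ∘ p) x∈
      ... | v , _ , eq = proj₁ (proj₂ (isKept y∈)) v (α-injective eq)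
      kept∉rest : ∀ {x} → Kept x →
        ¬ (x ∈ˡ map α kept ⊎ x ∈ˡ map p (allFin n) List.++ map (α ∘ p) (allFin n))
      kept∉rest (x< , _) (inj₁ x∈) with ∈-map⁻ α x∈
      ... | y , y∈ , refl = ℕ.<-asym (proj₁ (isKept y∈)) (subst (λ z → toℕ (α y) < toℕ z) (α-invol y) x<)
      kept∉rest (_ , x≢p , x≢αp) (inj₂ x∈) with ∈-++⁻ (map p (allFin n)) x∈
      ... | inj₁ x∈p  = let v , _ , eq = ∈-map⁻ p x∈p in x≢p v eq
      ... | inj₂ x∈αp = let v , _ , eq = ∈-map⁻ (α ∘ p) x∈αp in x≢αp v eq

    length-all : length all ≡ length kept + (length kept + (n + n))
    length-all = trans (length-++ kept) (cong (length kept +_)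
      (trans (length-++ (map α kept)) (cong₂ _+_ (length-map α kept)
        (trans (length-++ (map p (allFin n))) (cong₂ _+_
          (trans (length-map p (allFin n)) (length-tabulate {n = n} id))
          (trans (length-map (α ∘ p) (allFin n)) (length-tabulate {n = n} id)))))))

    enough : 2 + length kept ≤ length reps
    enough = ℕ.+-cancelˡ-≤ n _ _ (ℕ.*-cancelˡ-≤ 2 (begin
      2 * (n + (2 + length kept))                 ≡⟨ regroup n (length kept) ⟩
      4 + (length kept + (length kept + (n + n))) ≡⟨ cong (4 +_) length-all ⟨
      4 + length all                              ≤⟨ ℕ.+-monoʳ-≤ 4
        (unique-⊆⇒length≤ all-unique (λ {x} _ → ∈-allFin x)) ⟩
      4 + length (allFin d)                       ≡⟨ cong (4 +_) (length-tabulate {n = d} id) ⟩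
      4 + d                                       ≡⟨ euler ⟨
      2 * (n + length reps)                       ∎))
      where
      open ℕ.≤-Reasoning
      regroup : ∀ a b → 2 * (a + (2 + b)) ≡ 4 + (b + (b + (a + a)))
      regroup = solve-∀

    across : (g : Fin d → Bool) → (∀ {a b} → (a , b) ∈ˡ map sides kept → g a ≡ g b) →
      ∀ x → (∀ v → x ≢ p v) → (∀ v → x ≢ α (p v)) → g (face x) ≡ g (face (α x))
    across g g-es x x≢p x≢αp with ℕ.<-cmp (toℕ x) (toℕ (α x))
    ... | tri< x< _ _ = g-es (∈-map⁺ sides (∈-filter⁺ kept? (∈-allFin x) (x< , x≢p , x≢αp)))
    ... | tri≈ _ x≡ _ = contradiction (sym (Fin.toℕ-injective x≡)) (α-nofix x)
    ... | tri> _ _ x> = trans (cong (g ∘ face) (sym (α-invol x))) (sym (g-es (∈-map⁺ sides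
            (∈-filter⁺ kept? (∈-allFin (α x))
              ( subst (λ z → toℕ (α x) < toℕ z) (sym (α-invol x)) x>
              , (λ v eq → x≢αp v (trans (sym (α-invol x)) (cong α eq)))
              , (λ v eq → x≢p v (α-injective eq)))))))

-- Least witnesses, bounds, and the labels of vertices.

least : {P : ℕ → Set} → (∀ k → Dec (P k)) → ∀ {k} → P k → ∃[ m ] P m × (∀ {j} → P j → m ≤ j)
least P? {zero} p = 0 , p , λ _ → z≤n
least P? {suc k} p with P? 0
... | yes p₀ = 0 , p₀ , λ _ → z≤n
... | no ¬p₀ with least (P? ∘ suc) {k} p
...   | m , q , m≤ = suc m , q , λ { {zero} p₀ → contradiction p₀ ¬p₀ ; {suc j} pj → s≤s (m≤ pj) }

bounded : ∀ {m} (h : Fin m → ℕ) → ∃[ b ] (∀ i → h i ≤ b)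
bounded {zero}  h = 0 , λ ()
bounded {suc m} h = let b , h≤b = bounded (h ∘ suc) in
  h zero ⊔ b , λ { zero → ℕ.m≤m⊔n (h zero) b ; (suc i) → ℕ.≤-trans (h≤b i) (ℕ.m≤n⊔m (h zero) b) }

-- 𝐑 is the cut, 𝐀 and 𝐂 are two components of its complement, 𝐃 is the rest.
Part : Set
Part = Fin 4

pattern 𝐑 = zero
pattern 𝐀 = suc zero
pattern 𝐂 = suc (suc zero)
pattern 𝐃 = suc (suc (suc zero))

-- An edge with both ends here never belongs to the cycle built below, so colours do not change
-- across it.
Outer : Part → Set
Outer P = P ≡ 𝐑 ⊎ P ≡ 𝐃

-- Tree edges towards the root: 𝐃 hangs on 𝐑, and 𝐑 (apart from the roots) on 𝐀.
Allowed : Part → Part → Set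
Allowed P Q = (P ≡ Q × P ≢ 𝐑) ⊎ (P ≡ 𝐃 × Q ≡ 𝐑) ⊎ (P ≡ 𝐑 × Q ≡ 𝐀)

allowed? : ∀ P Q → Dec (Allowed P Q)
allowed? P Q = ((P ≟ Q) ×-dec ¬? (P ≟ 𝐑)) ⊎-dec (((P ≟ 𝐃) ×-dec (Q ≟ 𝐑)) ⊎-dec ((P ≟ 𝐑) ×-dec (Q ≟ 𝐀)))

-- Rotation at a vertex and colours along arcs.

module _ (G : PlaneGraph) where
  open PlaneGraph G

  -- The darts met when rotating from s up to and including the next a or c.
  data Arc (a c s : Fin d) : Fin d → Set where
    next : Arc a c s (σ s)
    pass : ∀ {y} → Arc a c s y → y ≢ a → y ≢ c → Arc a c s (σ y)

  arc-vert : ∀ {a c s x} → Arc a c s x → vert x ≡ vert s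
  arc-vert {s = s} next = vert-σ s
  arc-vert (pass {y} arc _ _) = trans (vert-σ y) (arc-vert arc)

  -- The rotation is followed from `σ a`, restarting whenever `a` is met and stopping at `c`. For
  -- `a ≡ c` this is a full turn around the vertex.
  arc-between : ∀ {a c} → vert a ≡ vert c → Arc a c a c
  arc-between {a} {c} eq with σ-cyclic (σ a) c (trans (vert-σ a) eq)
  ... | k , refl with go k
    where
    go : ∀ k → Arc a c a c ⊎ Arc a c a (iter σ k (σ a))
    go zero = inj₂ next
    go (suc k) with go k
    ... | inj₁ arc = inj₁ arc
    ... | inj₂ arc with iter σ k (σ a) ≟ a | iter σ k (σ a) ≟ c
    ...   | yes eq | _ = inj₂ (subst (λ y → Arc a c a (σ y)) (sym eq) next)
    ...   | no _ | yes eq = inj₁ (subst (Arc a c a) eq arc)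
    ...   | no ≢a | no ≢c = inj₂ (pass arc ≢a ≢c)
  ...   | inj₁ arc = arc
  ...   | inj₂ arc = arc

  -- The rotation restarts at every `a` or `c` it meets, so the last one met before `x` begins the
  -- arc.
  arc-from : ∀ {a c x} → vert a ≡ vert x → Arc a c a x ⊎ Arc a c c x
  arc-from {a} {c} {x} eq with σ-cyclic (σ a) x (trans (vert-σ a) eq)
  ... | k , refl = go k
    where
    go : ∀ k → Arc a c a (iter σ k (σ a)) ⊎ Arc a c c (iter σ k (σ a))
    go zero = inj₁ next
    go (suc k) with iter σ k (σ a) ≟ a | iter σ k (σ a) ≟ c
    ... | yes eq | _ = inj₁ (subst (λ y → Arc a c a (σ y)) (sym eq) next)
    ... | no _ | yes eq = inj₂ (subst (λ y → Arc a c c (σ y)) (sym eq) next)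
    ... | no ≢a | no ≢c = [ (λ arc → inj₁ (pass arc ≢a ≢c)) , (λ arc → inj₂ (pass arc ≢a ≢c)) ]′ (go k)

  module _ (g : Fin d → Bool) (g-φ : ∀ x → g (φ x) ≡ g x) where

    -- `σ x` is `φ (α x)`: rotating past `x` leads to the face on the other side of its edge.
    g-σ : ∀ x → g (σ x) ≡ g (α x)
    g-σ x = trans (cong (g ∘ σ) (sym (α-invol x))) (g-φ (α x))

    -- The darts strictly inside the arc have one colour on both sides, so the colour found just
    -- after `s`, that of `α s`, persists.
    arc-value : ∀ {a c s x} → (∀ y → vert y ≡ vert s → y ≢ a → y ≢ c → g y ≡ g (α y)) →
      Arc a c s x → g x ≡ g (α s)
    arc-value {s = s} same next = g-σ s
    arc-value same (pass {y} arc ≢a ≢c) =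
      trans (g-σ y) (trans (sym (same y (arc-vert arc) ≢a ≢c)) (arc-value same arc))

    constant-at : (v : Fin n) → (∀ y → vert y ≡ v → g y ≡ g (α y)) →
      ∀ x y → vert x ≡ v → vert y ≡ v → g x ≡ g y
    constant-at v same x y refl eq with σ-cyclic x y (sym eq)
    ... | k , refl = sym (go k)
      where
      iter-vert : ∀ k → vert (iter σ k x) ≡ vert x
      iter-vert zero = refl
      iter-vert (suc k) = trans (vert-σ _) (iter-vert k)
      go : ∀ k → g (iter σ k x) ≡ g x
      go zero = refl
      go (suc k) = trans (g-σ _) (trans (sym (same _ (iter-vert k))) (go k))

    -- All darts at a vertex of the walk share one colour, and an edge of the walk hands it to the
    -- next vertex.
    constant-along : (P : Fin n → Set) → (∀ x → P (vert x) → g x ≡ g (α x)) →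
      ∀ {u v} → P u → Walk (graphOf G) P u v → ∀ x y → vert x ≡ u → vert y ≡ v → g x ≡ g y
    constant-along P same Pu Walk.here x y = constant-at _ (λ { y refl → same y Pu }) x y
    constant-along P same Pu (Walk.step (z , refl , refl) Pw walk) x y x≡ y≡ = begin
      g x     ≡⟨ constant-at _ (λ y eq → same y (subst P (sym eq) Pu)) x z x≡ refl ⟩
      g z     ≡⟨ same z Pu ⟩
      g (α z) ≡⟨ constant-along P same Pw walk (α z) y refl y≡ ⟩
      g y     ∎
      where open ≡-Reasoning

  -- Face 2-colourings that change only across edges meeting 𝐀 or 𝐂 agree at x₁ and x₂.
  Linked : (Fin n → Part) → Fin d → Fin d → Set
  Linked lab x₁ x₂ = (g : Fin d → Bool) → (∀ x → g (φ x) ≡ g x) →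
    (∀ x → Outer (lab (vert x)) → Outer (lab (head G x)) → g x ≡ g (α x)) → g x₁ ≡ g x₂

  -- A cycle through two cut vertices, and its two sides.

  module Theta
    (connected : ConnectedMinus (graphOf G) ∅)
    (lab : Fin n → Part)
    (a₁ c₁ a₂ c₂ : Fin d)
    (r₁-def : vert a₁ ≡ vert c₁) (r₂-def : vert a₂ ≡ vert c₂) (r₁≢r₂ : vert c₁ ≢ vert a₂)
    (lab-r₁ : lab (vert c₁) ≡ 𝐑) (lab-r₂ : lab (vert a₂) ≡ 𝐑)
    (lab-a₁ : lab (head G a₁) ≡ 𝐀) (lab-a₂ : lab (head G a₂) ≡ 𝐀)
    (lab-c₁ : lab (head G c₁) ≡ 𝐂) (lab-c₂ : lab (head G c₂) ≡ 𝐂)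
    where

    r₁ r₂ : Fin n
    r₁ = vert c₁
    r₂ = vert a₂

    -- The vertices with a prescribed chosen dart. From the heads of `c₁` and `a₂` the cycle
    -- descends the trees of 𝐂 and 𝐀 to the last two of them.
    Root : Fin n → Set
    Root v = v ≡ r₁ ⊎ v ≡ r₂ ⊎ v ≡ head G a₁ ⊎ v ≡ head G c₂

    -- The chosen edges form a spanning subgraph with one cycle: from r₁ into the
    -- part 𝐂, along its tree to the head of c₂, to r₂, into 𝐀, and back to r₁.
    data Choice (rank : Fin n → ℕ) (v : Fin n) : Fin d → Set where
      at-r₁ : v ≡ r₁ → Choice rank v c₁
      at-r₂ : v ≡ r₂ → Choice rank v a₂
      at-a  : v ≡ head G a₁ → Choice rank v (α a₁)
      at-c  : v ≡ head G c₂ → Choice rank v (α c₂)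
      down  : ∀ {x} → ¬ Root v → vert x ≡ v → Allowed (lab v) (lab (head G x)) →
              rank (head G x) < rank v → Choice rank v x

    module Unicyclic (rank : Fin n → ℕ) (p : Fin n → Fin d) (spec : ∀ v → Choice rank v (p v)) where

      f : Fin n → Fin n
      f v = head G (p v)

      choice-vert : ∀ {v x} → Choice rank v x → vert x ≡ v
      choice-vert (at-r₁ eq) = sym eq
      choice-vert (at-r₂ eq) = sym eq
      choice-vert (at-a eq)  = sym eq
      choice-vert (at-c eq)  = sym eq
      choice-vert (down _ eq _ _) = eq

      p-vert : ∀ v → vert (p v) ≡ v
      p-vert v = choice-vert (spec v)

      clash : ∀ {u v P Q} → lab u ≡ P → lab v ≡ Q → P ≢ Q → u ≢ v
      clash labu labv P≢Q refl = P≢Q (trans (sym labu) labv)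

      head-αa₁ : head G (α a₁) ≡ r₁
      head-αa₁ = trans (cong vert (α-invol a₁)) r₁-def

      head-αc₂ : head G (α c₂) ≡ r₂
      head-αc₂ = trans (cong vert (α-invol c₂)) (sym r₂-def)

      p-r₁ : p r₁ ≡ c₁
      p-r₁ with p r₁ | spec r₁
      ... | _ | at-r₁ _ = refl
      ... | _ | at-r₂ eq = contradiction eq r₁≢r₂
      ... | _ | at-a eq = contradiction eq (clash lab-r₁ lab-a₁ λ ())
      ... | _ | at-c eq = contradiction eq (clash lab-r₁ lab-c₂ λ ())
      ... | _ | down ¬root _ _ _ = contradiction (inj₁ refl) ¬root

      p-r₂ : p r₂ ≡ a₂
      p-r₂ with p r₂ | spec r₂
      ... | _ | at-r₁ eq = contradiction (sym eq) r₁≢r₂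
      ... | _ | at-r₂ _ = refl
      ... | _ | at-a eq = contradiction eq (clash lab-r₂ lab-a₁ λ ())
      ... | _ | at-c eq = contradiction eq (clash lab-r₂ lab-c₂ λ ())
      ... | _ | down ¬root _ _ _ = contradiction (inj₂ (inj₁ refl)) ¬root

      p-a : p (head G a₁) ≡ α a₁
      p-a with p (head G a₁) | spec (head G a₁)
      ... | _ | at-r₁ eq = contradiction eq (clash lab-a₁ lab-r₁ λ ())
      ... | _ | at-r₂ eq = contradiction eq (clash lab-a₁ lab-r₂ λ ())
      ... | _ | at-a _ = refl
      ... | _ | at-c eq = contradiction eq (clash lab-a₁ lab-c₂ λ ())
      ... | _ | down ¬root _ _ _ = contradiction (inj₂ (inj₂ (inj₁ refl))) ¬root

      p-c : p (head G c₂) ≡ α c₂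
      p-c with p (head G c₂) | spec (head G c₂)
      ... | _ | at-r₁ eq = contradiction eq (clash lab-c₂ lab-r₁ λ ())
      ... | _ | at-r₂ eq = contradiction eq (clash lab-c₂ lab-r₂ λ ())
      ... | _ | at-a eq = contradiction eq (clash lab-c₂ lab-a₁ λ ())
      ... | _ | at-c _ = refl
      ... | _ | down ¬root _ _ _ = contradiction (inj₂ (inj₂ (inj₂ refl))) ¬root

      A-stays : ∀ {Q} → Allowed 𝐀 Q → Q ≡ 𝐀
      A-stays (inj₁ (refl , _)) = refl
      A-stays (inj₂ (inj₁ (() , _)))
      A-stays (inj₂ (inj₂ (() , _)))

      C-stays : ∀ {Q} → Allowed 𝐂 Q → Q ≡ 𝐂
      C-stays (inj₁ (refl , _)) = refl
      C-stays (inj₂ (inj₁ (() , _)))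
      C-stays (inj₂ (inj₂ (() , _)))

      down-A : ∀ {u v} → lab u ≡ 𝐀 → Allowed (lab u) (lab v) → lab v ≡ 𝐀
      down-A {v = v} eq ok = A-stays (subst (λ P → Allowed P (lab v)) eq ok)

      down-C : ∀ {u v} → lab u ≡ 𝐂 → Allowed (lab u) (lab v) → lab v ≡ 𝐂
      down-C {v = v} eq ok = C-stays (subst (λ P → Allowed P (lab v)) eq ok)

      -- A property preserved by `f` which shows that the cycle meets 𝐑 only in `r₁` and `r₂` and
      -- never enters 𝐃.
      data Cyclic (v : Fin n) : Set where
        cyc-r₁ : v ≡ r₁ → Cyclic v
        cyc-r₂ : v ≡ r₂ → Cyclic v
        cyc-A  : lab v ≡ 𝐀 → Cyclic v
        cyc-C  : lab v ≡ 𝐂 → Cyclic v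

      cyclic-step : ∀ {v x} → Choice rank v x → Cyclic v → Cyclic (head G x)
      cyclic-step (at-r₁ _) _ = cyc-C lab-c₁
      cyclic-step (at-r₂ _) _ = cyc-A lab-a₂
      cyclic-step (at-a _)  _ = cyc-r₁ head-αa₁
      cyclic-step (at-c _)  _ = cyc-r₂ head-αc₂
      cyclic-step (down ¬root _ _ _) (cyc-r₁ eq) = contradiction (inj₁ eq) ¬root
      cyclic-step (down ¬root _ _ _) (cyc-r₂ eq) = contradiction (inj₂ (inj₁ eq)) ¬root
      cyclic-step (down _ _ ok _) (cyc-A eq) = cyc-A (down-A eq ok)
      cyclic-step (down _ _ ok _) (cyc-C eq) = cyc-C (down-C eq ok)

      no-return-r₁ : ∀ {v w y} → v ≡ r₁ → Choice rank w y → head G c₁ ≡ w → head G y ≢ v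
      no-return-r₁ _  (at-r₁ eq) h _ = clash lab-c₁ lab-r₁ (λ ()) (trans h eq)
      no-return-r₁ _  (at-r₂ eq) h _ = clash lab-c₁ lab-r₂ (λ ()) (trans h eq)
      no-return-r₁ _  (at-a eq)  h _ = clash lab-c₁ lab-a₁ (λ ()) (trans h eq)
      -- The heads of `c₁` and `c₂` may coincide; here it is the distinctness of `r₁` and `r₂` that
      -- excludes a return.
      no-return-r₁ eq (at-c _)   _ h = r₁≢r₂ (trans (sym eq) (trans (sym h) head-αc₂))
      no-return-r₁ eq (down _ _ ok _) refl refl = clash (down-C lab-c₁ ok) lab-r₁ (λ ()) eq

      no-return-r₂ : ∀ {v w y} → v ≡ r₂ → Choice rank w y → head G a₂ ≡ w → head G y ≢ v
      no-return-r₂ eq (at-r₁ eq′) h h′ = no-return-r₁ eq′ (at-r₂ eq) h′ h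
      no-return-r₂ _  (at-r₂ eq) h _ = clash lab-a₂ lab-r₂ (λ ()) (trans h eq)
      no-return-r₂ eq (at-a _)   _ h = r₁≢r₂ (trans (sym head-αa₁) (trans h eq))
      no-return-r₂ _  (at-c eq)  h _ = clash lab-a₂ lab-c₂ (λ ()) (trans h eq)
      no-return-r₂ eq (down _ _ ok _) refl refl = clash (down-A lab-a₂ ok) lab-r₂ (λ ()) eq

      no-return-a : ∀ {v w y} → v ≡ head G a₁ → Choice rank w y → head G (α a₁) ≡ w → head G y ≢ v
      no-return-a eq (at-r₁ eq′) h h′ = no-return-r₁ eq′ (at-a eq) h′ h
      no-return-a eq (at-r₂ eq′) h h′ = no-return-r₂ eq′ (at-a eq) h′ h
      no-return-a _ (at-a eq) h _ = clash lab-r₁ lab-a₁ (λ ()) (trans (sym head-αa₁) (trans h eq))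
      no-return-a _ (at-c eq) h _ = clash lab-r₁ lab-c₂ (λ ()) (trans (sym head-αa₁) (trans h eq))
      no-return-a _ (down ¬root _ _ _) h _ = ¬root (inj₁ (trans (sym h) head-αa₁))

      no-return-c : ∀ {v w y} → v ≡ head G c₂ → Choice rank w y → head G (α c₂) ≡ w → head G y ≢ v
      no-return-c eq (at-r₁ eq′) h h′ = no-return-r₁ eq′ (at-c eq) h′ h
      no-return-c eq (at-r₂ eq′) h h′ = no-return-r₂ eq′ (at-c eq) h′ h
      no-return-c eq (at-a eq′)  h h′ = no-return-a eq′ (at-c eq) h′ h
      no-return-c _ (at-c eq) h _ = clash lab-r₂ lab-c₂ (λ ()) (trans (sym head-αc₂) (trans h eq))
      no-return-c _ (down ¬root _ _ _) h _ = ¬root (inj₂ (inj₁ (trans (sym h) head-αc₂)))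

      -- Two tree edges would make the rank drop in both directions; prescribed darts are excluded
      -- by the labels of their ends or by `r₁≢r₂`. Hence the n chosen darts lie on n different
      -- edges.
      no-return : ∀ {v w x y} → Choice rank v x → Choice rank w y → head G x ≡ w → head G y ≢ v
      no-return (at-r₁ eq) y h h′ = no-return-r₁ eq y h h′
      no-return (at-r₂ eq) y h h′ = no-return-r₂ eq y h h′
      no-return (at-a eq)  y h h′ = no-return-a eq y h h′
      no-return (at-c eq)  y h h′ = no-return-c eq y h h′
      no-return x (at-r₁ eq) h h′ = no-return-r₁ eq x h′ h
      no-return x (at-r₂ eq) h h′ = no-return-r₂ eq x h′ h
      no-return x (at-a eq)  h h′ = no-return-a eq x h′ h
      no-return x (at-c eq)  h h′ = no-return-c eq x h′ h
      no-return (down _ _ _ lt) (down _ _ _ lt′) refl refl = ℕ.<-asym lt lt′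

      p-noback : ∀ v w → p v ≢ α (p w)
      p-noback v w eq = no-return (spec v) (spec w)
        (trans (cong (head G) eq) (trans (cong vert (α-invol (p w))) (p-vert w)))
        (trans (cong vert (sym eq)) (p-vert v))

      -- The forward orbit of `r₁`, which closes up because `f` sends the head of `a₁` back to `r₁`.
      OnCycle : Fin n → Set
      OnCycle v = ∃[ k ] iter f k r₁ ≡ v

      onCycle-f : ∀ {v} → OnCycle v → OnCycle (f v)
      onCycle-f (k , eq) = suc k , cong f eq

      onCycle-subst : ∀ {v w} → f v ≡ w → OnCycle v → OnCycle w
      onCycle-subst refl = onCycle-f

      cyclic : ∀ k → Cyclic (iter f k r₁)
      cyclic zero    = cyc-r₁ refl
      cyclic (suc k) = cyclic-step (spec _) (cyclic k)

      -- Chosen darts stay in 𝐂 and lower the rank until the head of `c₂` is reached.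
      onCycle-C : ∀ v → lab v ≡ 𝐂 → OnCycle v → OnCycle (head G c₂)
      onCycle-C v = <-rec (λ t → ∀ v → rank v ≡ t → lab v ≡ 𝐂 → OnCycle v → OnCycle (head G c₂))
                      below (rank v) v refl
        where
        below : ∀ t → (∀ {s} → s < t → ∀ v → rank v ≡ s → lab v ≡ 𝐂 → OnCycle v → OnCycle (head G c₂)) →
          ∀ v → rank v ≡ t → lab v ≡ 𝐂 → OnCycle v → OnCycle (head G c₂)
        below t rec v refl lab-v on with p v | spec v | onCycle-f on
        ... | _ | at-r₁ eq | _ = contradiction eq (clash lab-v lab-r₁ λ ())
        ... | _ | at-r₂ eq | _ = contradiction eq (clash lab-v lab-r₂ λ ())
        ... | _ | at-a eq  | _ = contradiction eq (clash lab-v lab-a₁ λ ())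
        ... | _ | at-c refl | _ = on
        ... | _ | down _ _ ok lt | on′ = rec lt _ refl (down-C lab-v ok) on′

      onCycle-A : ∀ v → lab v ≡ 𝐀 → OnCycle v → OnCycle (head G a₁)
      onCycle-A v = <-rec (λ t → ∀ v → rank v ≡ t → lab v ≡ 𝐀 → OnCycle v → OnCycle (head G a₁))
                      below (rank v) v refl
        where
        below : ∀ t → (∀ {s} → s < t → ∀ v → rank v ≡ s → lab v ≡ 𝐀 → OnCycle v → OnCycle (head G a₁)) →
          ∀ v → rank v ≡ t → lab v ≡ 𝐀 → OnCycle v → OnCycle (head G a₁)
        below t rec v refl lab-v on with p v | spec v | onCycle-f on
        ... | _ | at-r₁ eq | _ = contradiction eq (clash lab-v lab-r₁ λ ())
        ... | _ | at-r₂ eq | _ = contradiction eq (clash lab-v lab-r₂ λ ())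
        ... | _ | at-a refl | _ = on
        ... | _ | at-c eq  | _ = contradiction eq (clash lab-v lab-c₂ λ ())
        ... | _ | down _ _ ok lt | on′ = rec lt _ refl (down-A lab-v ok) on′

      on-r₁ : OnCycle r₁
      on-r₁ = 0 , refl

      on-c : OnCycle (head G c₂)
      on-c = onCycle-C (head G c₁) lab-c₁ (onCycle-subst (cong (head G) p-r₁) on-r₁)

      f-c : f (head G c₂) ≡ r₂
      f-c = trans (cong (head G) p-c) head-αc₂

      on-r₂ : OnCycle r₂
      on-r₂ = onCycle-subst f-c on-c

      on-a : OnCycle (head G a₁)
      on-a = onCycle-A (head G a₂) lab-a₂ (onCycle-subst (cong (head G) p-r₂) on-r₂)

      f-a : f (head G a₁) ≡ r₁
      f-a = trans (cong (head G) p-a) head-αa₁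

      -- If the head of `a₁` comes after `ℓ` steps, then `suc ℓ` is a period, and `iter f ℓ` inverts
      -- `f` on the cycle.
      onCycle-injective : ∀ {v w} → OnCycle v → OnCycle w → f v ≡ f w → v ≡ w
      onCycle-injective on on′ eq = trans (sym (return on)) (trans (cong (iter f ℓ) eq) (return on′))
        where
        ℓ : ℕ
        ℓ = proj₁ on-a
        return : ∀ {v} → OnCycle v → iter f ℓ (f v) ≡ v
        return {v} (k , refl) = begin
          iter f ℓ (f (iter f k r₁))    ≡⟨ iter-suc f ℓ _ ⟨
          iter f (suc ℓ) (iter f k r₁)  ≡⟨ iter-+ f (suc ℓ) k r₁ ⟨
          iter f (suc ℓ + k) r₁         ≡⟨ cong (λ j → iter f j r₁) (ℕ.+-comm (suc ℓ) k) ⟩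
          iter f (k + suc ℓ) r₁         ≡⟨ iter-+ f k (suc ℓ) r₁ ⟩
          iter f k (f (iter f ℓ r₁))    ≡⟨ cong (iter f k ∘ f) (proj₂ on-a) ⟩
          iter f k (f (head G a₁))      ≡⟨ cong (iter f k) f-a ⟩
          iter f k r₁                   ∎
          where open ≡-Reasoning

      -- All four roots lie on the cycle, so only `down` remains.
      off-rank : ∀ v → ¬ OnCycle v → rank (f v) < rank v
      off-rank v off with p v | spec v
      ... | _ | at-r₁ refl = contradiction on-r₁ off
      ... | _ | at-r₂ refl = contradiction on-r₂ off
      ... | _ | at-a refl = contradiction on-a off
      ... | _ | at-c refl = contradiction on-c off
      ... | _ | down _ _ _ lt = lt

      module _ (g : Fin d → Bool) (g-φ : ∀ x → g (φ x) ≡ g x)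
        (g-α : ∀ x → (∀ v → x ≢ p v) → (∀ v → x ≢ α (p v)) → g x ≡ g (α x)) where

        Flat : Fin d → Set
        Flat x = g x ≡ g (α x)

        flat-α : ∀ x → Flat x → Flat (α x)
        flat-α x eq = trans (sym eq) (cong g (sym (α-invol x)))

        flat-at : ∀ x → (∀ v → x ≡ p v → Flat x) → (∀ v → x ≡ α (p v) → Flat x) → Flat x
        flat-at x by-p by-αp = bool-stable λ bent →
          bent (g-α x (λ v eq → bent (by-p v eq)) (λ v eq → bent (by-αp v eq)))

        flat-αp : ∀ {x v} → x ≡ α (p v) → Flat (p v) → Flat x
        flat-αp {v = v} refl = flat-α (p v)

        tail-p : ∀ {x v w} → vert x ≡ v → x ≡ p w → w ≡ v
        tail-p {w = w} refl refl = sym (p-vert w)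

        -- The deepest vertices off the cycle have no chosen edge but their own.
        off-flat : ∀ v → ¬ OnCycle v → Flat (p v)
        off-flat v = <-rec (λ t → ∀ v → M ∸ rank v ≡ t → ¬ OnCycle v → Flat (p v))
                       below (M ∸ rank v) v refl
          where
          M : ℕ
          M = proj₁ (bounded rank)
          below : ∀ t → (∀ {s} → s < t → ∀ v → M ∸ rank v ≡ s → ¬ OnCycle v → Flat (p v)) →
            ∀ v → M ∸ rank v ≡ t → ¬ OnCycle v → Flat (p v)
          -- Every other chosen edge at `v` comes from a vertex of higher rank off the cycle and is
          -- flat by induction. A full turn around `v` then compares the two sides of `p v`.
          below t rec v refl off = arc-value g g-φ others (arc-between refl)
            where
            others : ∀ y → vert y ≡ vert (p v) → y ≢ p v → y ≢ p v → Flat y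
            others y y-at y≢ _ = flat-at y
              (λ w eq → contradiction (trans eq (cong p (trans (tail-p y-at eq) (p-vert v)))) y≢)
              λ w eq → let fw≡v = trans (cong vert (sym eq)) (trans y-at (p-vert v))
                           w-off = λ on → off (onCycle-subst fw≡v on)
                       in flat-αp eq (rec (ℕ.∸-monoʳ-< (subst (λ u → rank u < rank w) fw≡v (off-rank w w-off))
                                             (proj₂ (bounded rank) w)) w refl w-off)

        -- Apart from the incoming and the outgoing edge, a chosen edge at a cycle vertex starts off
        -- the cycle, since `f` is injective on the cycle.
        cycle-flat : ∀ {w} → OnCycle w → ∀ y → vert y ≡ f w → y ≢ p (f w) → y ≢ α (p w) → Flat y
        cycle-flat {w} on y y-at y≢p y≢αp = flat-at y
          (λ u eq → contradiction (trans eq (cong p (tail-p y-at eq))) y≢p)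
          λ u eq → flat-αp eq (off-flat u λ u-on → y≢αp (trans eq (cong (α ∘ p)
            (onCycle-injective u-on on (trans (cong vert (sym eq)) y-at)))))

        -- Rotating from the incoming to the outgoing edge crosses flat edges only, which carries
        -- the colour of one side along the cycle. The complementary rotation serves `on-right`.
        on-left : ∀ {v} → OnCycle v → g (p v) ≡ g c₁
        on-left (zero , refl) = cong g p-r₁
        on-left (suc k , refl) = trans
          (arc-value g g-φ
            (λ y y-at y≢αp y≢p → cycle-flat (k , refl) y y-at y≢p y≢αp)
            (arc-between (sym (p-vert _))))
          (trans (cong g (α-invol _)) (on-left (k , refl)))

        on-right : ∀ {v} → OnCycle v → g (α (p v)) ≡ g (α c₁)
        on-right (zero , refl) = cong (g ∘ α) p-r₁
        on-right (suc k , refl) = trans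
          (sym (arc-value g g-φ
            (λ y y-at y≢p y≢αp → cycle-flat (k , refl) y (trans y-at (p-vert _)) y≢p y≢αp)
            (arc-between (p-vert _))))
          (on-right (k , refl))

        -- Equal colours on the two sides would make every edge flat, and the colouring constant
        -- because G is connected.
        sides-differ : ∃₂ (λ x y → g x ≢ g y) → g c₁ ≢ g (α c₁)
        sides-differ (x , y , gx≢gy) eq = gx≢gy
          (constant-along g g-φ (λ v → InMinus (graphOf G) ∅ v) (λ z _ → flat z)
            in⊤ (connected (vert x) (vert y) in⊤ in⊤) x y refl refl)
          where
          in⊤ : ∀ {v} → InMinus (graphOf G) ∅ v
          in⊤ = Subset.∈⊤ , Subset.∉⊥
          flat-p : ∀ v → Flat (p v)
          flat-p v = bool-stable λ bent → bent (off-flat v λ on →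
            bent (trans (on-left on) (trans eq (sym (on-right on)))))
          flat : ∀ z → Flat z
          flat z = flat-at z (λ { v refl → flat-p v }) (λ v eq′ → flat-αp eq′ (flat-p v))

        -- The cycle leaves `r₁` into 𝐂 and `r₂` into 𝐀, and all its other edges start in 𝐀 or 𝐂.
        outer-flat : ∀ x → Outer (lab (vert x)) → Outer (lab (head G x)) → Flat x
        outer-flat x out out′ = flat-at x
          (λ { v refl → off-flat v (off v (subst (Outer ∘ lab) (p-vert v) out) out′) })
          (λ { v refl → flat-α (p v) (off-flat v (off v
                 (subst (Outer ∘ lab) (trans (cong vert (α-invol (p v))) (p-vert v)) out′) out)) })
          where
          outer≢A : ∀ {v} → Outer (lab v) → lab v ≢ 𝐀
          outer≢A (inj₁ eq) eq′ = case trans (sym eq) eq′ of λ ()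
          outer≢A (inj₂ eq) eq′ = case trans (sym eq) eq′ of λ ()
          outer≢C : ∀ {v} → Outer (lab v) → lab v ≢ 𝐂
          outer≢C (inj₁ eq) eq′ = case trans (sym eq) eq′ of λ ()
          outer≢C (inj₂ eq) eq′ = case trans (sym eq) eq′ of λ ()
          off : ∀ v → Outer (lab v) → Outer (lab (f v)) → ¬ OnCycle v
          off v out out′ (k , refl) with cyclic k
          ... | cyc-r₁ eq = outer≢C out′ (trans (cong (lab ∘ f) eq) (trans (cong (lab ∘ head G) p-r₁) lab-c₁))
          ... | cyc-r₂ eq = outer≢A out′ (trans (cong (lab ∘ f) eq) (trans (cong (lab ∘ head G) p-r₂) lab-a₂))
          ... | cyc-A eq = outer≢A out eq
          ... | cyc-C eq = outer≢C out eq

        -- The cycle enters `r₁` along `a₁` and leaves along `c₁`, but enters `r₂` along `c₂` and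
        -- leaves along `a₂`. So the arc starting at the dart to 𝐀 is on the left at `r₁` and on the
        -- right at `r₂`.
        left-r₁ : ∀ {x} → Arc a₁ c₁ a₁ x → g x ≡ g c₁
        left-r₁ arc = trans (arc-value g g-φ at-r₁-flat arc)
          (trans (cong g (sym p-a)) (on-left on-a))
          where
          at-r₁-flat : ∀ y → vert y ≡ vert a₁ → y ≢ a₁ → y ≢ c₁ → Flat y
          at-r₁-flat y y-at y≢a y≢c = cycle-flat on-a y (trans y-at (trans r₁-def (sym f-a)))
            (λ eq → y≢c (trans eq (trans (cong p f-a) p-r₁)))
            (λ eq → y≢a (trans eq (trans (cong α p-a) (α-invol a₁))))

        right-r₁ : ∀ {x} → Arc a₁ c₁ c₁ x → g x ≡ g (α c₁)
        right-r₁ arc = arc-value g g-φ at-r₁-flat arc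
          where
          at-r₁-flat : ∀ y → vert y ≡ vert c₁ → y ≢ a₁ → y ≢ c₁ → Flat y
          at-r₁-flat y y-at y≢a y≢c = cycle-flat on-a y (trans y-at (sym f-a))
            (λ eq → y≢c (trans eq (trans (cong p f-a) p-r₁)))
            (λ eq → y≢a (trans eq (trans (cong α p-a) (α-invol a₁))))

        at-r₂-flat : ∀ y → vert y ≡ vert a₂ → y ≢ a₂ → y ≢ c₂ → Flat y
        at-r₂-flat y y-at y≢a y≢c = cycle-flat on-c y (trans y-at (sym f-c))
          (λ eq → y≢a (trans eq (trans (cong p f-c) p-r₂)))
          (λ eq → y≢c (trans eq (trans (cong α p-c) (α-invol c₂))))

        right-r₂ : ∀ {x} → Arc a₂ c₂ a₂ x → g x ≡ g (α c₁)
        right-r₂ arc = trans (arc-value g g-φ at-r₂-flat arc)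
          (trans (cong (g ∘ α) (sym p-r₂)) (on-right on-r₂))

        left-r₂ : ∀ {x} → Arc a₂ c₂ c₂ x → g x ≡ g c₁
        left-r₂ arc = trans (arc-value g g-φ (λ y y-at → at-r₂-flat y (trans y-at (sym r₂-def))) arc)
          (trans (cong g (sym p-c)) (on-left on-c))

      -- Arcs in the same rotational position at `r₁` and `r₂` lie on opposite sides of the cycle,
      -- while linked darts have the same colour.
      opposite-arcs : ∀ {x₁ x₂} → Linked lab x₁ x₂ →
        ¬ (Arc a₁ c₁ a₁ x₁ × Arc a₂ c₂ a₂ x₂) × ¬ (Arc a₁ c₁ c₁ x₁ × Arc a₂ c₂ c₂ x₂)
      opposite-arcs same =
        let g , g-φ , g-α , bent = jordan G p p-vert p-noback
            differ = sides-differ g g-φ g-α bent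
            g-same = same g g-φ (outer-flat g g-φ g-α)
        in (λ (arc₁ , arc₂) → differ
             (trans (sym (left-r₁ g g-φ g-α arc₁)) (trans g-same (right-r₂ g g-φ g-α arc₂))))
         , (λ (arc₁ , arc₂) → differ
             (trans (sym (left-r₂ g g-φ g-α arc₂)) (trans (sym g-same) (right-r₁ g g-φ g-α arc₁))))

    -- Ranks as distances to the roots.

    root? : ∀ v → Dec (Root v)
    root? v = (v ≟ r₁) ⊎-dec ((v ≟ r₂) ⊎-dec ((v ≟ head G a₁) ⊎-dec (v ≟ head G c₂)))

    Within : ℕ → Fin n → Set
    Within zero    v = Root v
    Within (suc k) v = ∃[ x ] vert x ≡ v × Allowed (lab v) (lab (head G x)) × Within k (head G x)

    within? : ∀ v k → Dec (Within k v)
    within? v zero    = root? v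
    within? v (suc k) = Fin.any? λ x →
      (vert x ≟ v) ×-dec allowed? (lab v) (lab (head G x)) ×-dec within? (head G x) k

    module _ (reach : ∀ v → ∃[ k ] Within k v) where

      nearest : ∀ v → ∃[ m ] Within m v × (∀ {j} → Within j v → m ≤ j)
      nearest v = least (within? v) (proj₂ (reach v))

      rank : Fin n → ℕ
      rank v = proj₁ (nearest v)

      choose : ∀ v → ∃ (Choice rank v)
      choose v with root? v
      ... | yes (inj₁ eq)               = c₁ , at-r₁ eq
      ... | yes (inj₂ (inj₁ eq))        = a₂ , at-r₂ eq
      ... | yes (inj₂ (inj₂ (inj₁ eq))) = α a₁ , at-a eq
      ... | yes (inj₂ (inj₂ (inj₂ eq))) = α c₂ , at-c eq
      ... | no ¬root with nearest v in eq
      ...   | zero , root , _ = contradiction root ¬root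
      -- The head of `x` reaches a root in `m` steps, so its least distance is at most `m`.
      ...   | suc m , (x , vx , ok , w) , _ = x , down ¬root vx ok
                (subst (λ t → rank (head G x) < proj₁ t) (sym eq) (s≤s (proj₂ (proj₂ (nearest (head G x))) w)))

      theta : ∀ {x₁ x₂} → Linked lab x₁ x₂ →
        ¬ (Arc a₁ c₁ a₁ x₁ × Arc a₂ c₂ a₂ x₂) × ¬ (Arc a₁ c₁ c₁ x₁ × Arc a₂ c₂ c₂ x₂)
      theta = Unicyclic.opposite-arcs rank (proj₁ ∘ choose) (proj₂ ∘ choose)

-- Walks and the decidability of reachability.

module _ {N : ℕ} {E : Fin N → Fin N → Set} (E? : ∀ u v → Dec (E u v)) where

  -- Warshall's recursion: the listed vertices are the permitted intermediate stops.
  Via : List (Fin N) → Fin N → Fin N → Set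
  Via []       u v = u ≡ v ⊎ E u v
  Via (s ∷ ss) u v = Via ss u v ⊎ (Via ss u s × Via ss s v)

  via? : ∀ ss u v → Dec (Via ss u v)
  via? []       u v = (u ≟ v) ⊎-dec E? u v
  via? (s ∷ ss) u v = via? ss u v ⊎-dec (via? ss u s ×-dec via? ss s v)

  via-base : ∀ ss {u v} → u ≡ v ⊎ E u v → Via ss u v
  via-base []       e = e
  via-base (s ∷ ss) e = inj₁ (via-base ss e)

  via-to : ∀ {ss s u} → Via (s ∷ ss) u s → Via ss u s
  via-to (inj₁ p)       = p
  via-to (inj₂ (p , _)) = p

  via-from : ∀ {ss s v} → Via (s ∷ ss) s v → Via ss s v
  via-from (inj₁ p)       = p
  via-from (inj₂ (_ , p)) = p

  via-join : ∀ ss {s u v} → s ∈ˡ ss → Via ss u s → Via ss s v → Via ss u v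
  via-join (s ∷ ss) (here refl) p q = inj₂ (via-to p , via-from q)
  via-join (t ∷ ss) (there s∈) (inj₁ p) (inj₁ q) = inj₁ (via-join ss s∈ p q)
  via-join (t ∷ ss) (there s∈) (inj₁ p) (inj₂ (q , q′)) = inj₂ (via-join ss s∈ p q , q′)
  via-join (t ∷ ss) (there s∈) (inj₂ (p , p′)) (inj₁ q) = inj₂ (p , via-join ss s∈ p′ q)
  -- The detour between the two visits to `t` is dropped.
  via-join (t ∷ ss) (there s∈) (inj₂ (p , _)) (inj₂ (_ , q)) = inj₂ (p , q)

module _ {H : Graph} where
  open Graph H

  module _ {P : Fin N → Set} where

    walk-trans : ∀ {u v w} → Walk H P u v → Walk H P v w → Walk H P u w
    walk-trans here q = q
    walk-trans (step e Pw p) q = step e Pw (walk-trans p q)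

    walk-end : ∀ {u v} → P u → Walk H P u v → P v
    walk-end Pu here = Pu
    walk-end _ (step _ Pw p) = walk-end Pw p

    walk-sym : (∀ {u v} → Adj u v → Adj v u) → ∀ {u v} → P u → Walk H P u v → Walk H P v u
    walk-sym adj-sym Pu here = here
    walk-sym adj-sym Pu (step e Pw p) = walk-trans (walk-sym adj-sym Pw p) (step (adj-sym e) Pu here)

    -- Confines a walk to the component of `s`, so that `constant-along` can use membership in it.
    walk-history : ∀ {s u v} → Walk H P s u → Walk H P u v → Walk H (λ w → P w × Walk H P s w) u v
    walk-history h here = here
    walk-history h (step e Pw p) = step e (Pw , h′) (walk-history h′ p)
      where h′ = walk-trans h (step e Pw here)

  walk? : (∀ u v → Dec (Adj u v)) → {P : Fin N → Set} → (∀ v → Dec (P v)) →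
    ∀ u v → Dec (Walk H P u v)
  walk? adj? {P} P? u v = map′ (via⇒walk (allFin N)) walk⇒via (via? E? (allFin N) u v)
    where
    -- `P` is attached to the end of each edge because a walk does not constrain its first vertex.
    E : Fin N → Fin N → Set
    E u w = Adj u w × P w
    E? : ∀ u w → Dec (E u w)
    E? u w = adj? u w ×-dec P? w
    via⇒walk : ∀ ss {u v} → Via E? ss u v → Walk H P u v
    via⇒walk []       (inj₁ refl)     = here
    via⇒walk []       (inj₂ (e , Pw)) = step e Pw here
    via⇒walk (s ∷ ss) (inj₁ p)        = via⇒walk ss p
    via⇒walk (s ∷ ss) (inj₂ (p , q))  = walk-trans (via⇒walk ss p) (via⇒walk ss q)
    walk⇒via : ∀ {u v} → Walk H P u v → Via E? (allFin N) u v
    walk⇒via here = via-base E? (allFin N) (inj₁ refl)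
    walk⇒via (step {w = w} e Pw p) =
      via-join E? (allFin N) (∈-allFin w) (via-base E? (allFin N) (inj₂ (e , Pw))) (walk⇒via p)

-- Choosing elements of a finite subset.

remove-element : ∀ {m k} (p : Subset m) → suc k ≤ ∣ p ∣ →
  ∃[ x ] x ∈ p × k ≤ ∣ p - x ∣
remove-element (inside ∷ p) (s≤s k≤) =
  zero , here , subst (λ q → _ ≤ ∣ q ∣) (sym (Subset.p─⊥≡p p)) k≤
remove-element (outside ∷ p) k≤ = let x , x∈ , k≤′ = remove-element p k≤ in
  suc x , there x∈ , k≤′

∈-remove : ∀ {m} {p : Subset m} {x y} → y ∈ p - x → y ∈ p × y ≢ x
∈-remove {p = p} {x} y∈ = Subset.p─q⊆p p ⁅ x ⁆ y∈ , λ { refl → notIn p x y∈ }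
  where
  notIn : ∀ {m} (p : Subset m) x → ¬ (x ∈ p - x)
  notIn (outside ∷ p) zero ()
  notIn (inside ∷ p)  zero ()
  notIn (_ ∷ p) (suc x) (there x∈) = notIn p x x∈

three-elements : ∀ {m} (p : Subset m) → 3 ≤ ∣ p ∣ → ∃[ x ] ∃[ y ] ∃[ z ]
  (x ∈ p × y ∈ p × z ∈ p) × (x ≢ y × x ≢ z × y ≢ z)
three-elements p 3≤ =
  let x , x∈ , 2≤ = remove-element p 3≤
      y , y∈ , 1≤ = remove-element (p - x) 2≤
      z , z∈ , _  = remove-element (p - x - y) 1≤
      y∈p , y≢x  = ∈-remove y∈
      z∈′ , z≢y  = ∈-remove z∈
      z∈p , z≢x  = ∈-remove z∈′
  in x , y , z , (x∈ , y∈p , z∈p) , (≢-sym y≢x , ≢-sym z≢x , ≢-sym z≢y)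

-- Components of G - R for a minimal cut R.

module _ (G : PlaneGraph) where
  open PlaneGraph G

  adjG? : ∀ u v → Dec (AdjG G u v)
  adjG? u v = Fin.any? λ x → (vert x ≟ u) ×-dec (vert (α x) ≟ v)

  adjG-sym : ∀ {u v} → AdjG G u v → AdjG G v u
  adjG-sym (x , refl , refl) = α x , refl , cong vert (α-invol x)

  module Cut (three-connected : KConnected (graphOf G) 3) (R : Subset n)
             (R-min : IsMinimalCut (graphOf G) R) where

    InR : Fin n → Set
    InR = InMinus (graphOf G) R

    inR : ∀ {v} → v ∉ R → InR v
    inR v∉ = Subset.∈⊤ , v∉

    infix 4 _~_ _~?_
    _~_ : Fin n → Fin n → Set
    _~_ = Walk (graphOf G) InR

    _~?_ : ∀ u v → Dec (u ~ v)
    _~?_ = walk? adjG? λ v → (v Subset.∈? ⊤) ×-dec ¬? (v Subset.∈? R)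

    ~-sym : ∀ {u v} → u ∉ R → u ~ v → v ~ u
    ~-sym u∉ = walk-sym adjG-sym (inR u∉)

    ~-end : ∀ {u v} → u ∉ R → u ~ v → v ∉ R
    ~-end u∉ p = proj₂ (walk-end (inR u∉) p)

    -- Restoring `r` connects the graph by minimality, and the first arrival at `r` on a walk from
    -- `u` comes from the component of `u`.
    touches : ∀ {u r} → u ∉ R → r ∈ R → ∃[ x ] vert x ≡ r × u ~ head G x × head G x ∉ R
    touches {u} {r} u∉ r∈ = go u∉ (proj₂ R-min (R - r) (Subset.x∈p⇒p-x⊂p r∈) u r
        (Subset.∈⊤ , u∉ ∘ proj₁ ∘ ∈-remove) (Subset.∈⊤ , λ r∈- → proj₂ (∈-remove r∈-) refl))
      where
      go : ∀ {u} → u ∉ R → Walk (graphOf G) (InMinus (graphOf G) (R - r)) u r →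
        ∃[ x ] vert x ≡ r × u ~ head G x × head G x ∉ R
      go u∉ here = contradiction r∈ u∉
      go u∉ (step {w = w} (x , refl , refl) (_ , w∉) p) with vert (α x) ≟ r
      ... | yes eq = α x , eq , subst (vert x ~_) (sym (cong vert (α-invol x))) here
                   , subst (_∉ R) (sym (cong vert (α-invol x))) u∉
      ... | no w≢r = let w∉R = λ w∈ → w∉ (Subset.x∈p∧x≢y⇒x∈p-y w∈ w≢r)
                         y , vy , w~ , y∉ = go w∉R p
                     in y , vy , step (x , refl , refl) (inR w∉R) w~ , y∉

    -- Reachability is decidable, so the failure of connectedness yields an actual pair.
    split : ∃₂ λ a c → a ∉ R × c ∉ R × ¬ (a ~ c)
    split with Fin.any? (λ a → Fin.any? (λ c →
                 ¬? (a Subset.∈? R) ×-dec ¬? (c Subset.∈? R) ×-dec ¬? (a ~? c)))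
    ... | yes found = found
    ... | no ¬found = contradiction
      (λ a c (_ , a∉) (_ , c∉) → decidable-stable (a ~? c) λ a≁c → ¬found (a , c , a∉ , c∉ , a≁c))
      (proj₂ (proj₁ R-min))

    three-in-R : 3 ≤ ∣ R ∣
    three-in-R = ℕ.≮⇒≥ λ R<3 → proj₂ (proj₁ R-min)
      (proj₂ three-connected R (λ _ → Subset.∈⊤) R<3)

    connected : ConnectedMinus (graphOf G) ∅
    connected = proj₂ three-connected ∅ (λ v∈ → contradiction v∈ Subset.∉⊥)
      (subst (_< 3) (sym (Subset.∣⊥∣≡0 n)) (s≤s z≤n))

    module TwoSides (a c : Fin n) (a∉ : a ∉ R) (c∉ : c ∉ R) (a≁c : ¬ (a ~ c)) where

      lab : Fin n → Part
      lab v with v Subset.∈? R | a ~? v | c ~? v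
      ... | yes _ | _     | _     = 𝐑
      ... | no _  | yes _ | _     = 𝐀
      ... | no _  | no _  | yes _ = 𝐂
      ... | no _  | no _  | no _  = 𝐃

      lab-R : ∀ {v} → v ∈ R → lab v ≡ 𝐑
      lab-R {v} v∈ with v Subset.∈? R
      ... | yes _ = refl
      ... | no v∉ = contradiction v∈ v∉

      lab-A : ∀ {v} → a ~ v → lab v ≡ 𝐀
      lab-A {v} a~v with v Subset.∈? R | a ~? v
      ... | yes v∈ | _ = contradiction v∈ (~-end a∉ a~v)
      ... | no _ | yes _ = refl
      ... | no _ | no a≁v = contradiction a~v a≁v

      lab-C : ∀ {v} → c ~ v → lab v ≡ 𝐂
      lab-C {v} c~v with v Subset.∈? R | a ~? v | c ~? v
      ... | yes v∈ | _ | _ = contradiction v∈ (~-end c∉ c~v)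
      ... | no _ | yes a~v | _ = contradiction (walk-trans a~v (~-sym c∉ c~v)) a≁c
      ... | no _ | no _ | yes _ = refl
      ... | no _ | no _ | no c≁v = contradiction c~v c≁v

      lab-D : ∀ {v} → v ∉ R → ¬ (a ~ v) → ¬ (c ~ v) → lab v ≡ 𝐃
      lab-D {v} v∉ a≁v c≁v with v Subset.∈? R | a ~? v | c ~? v
      ... | yes v∈ | _ | _ = contradiction v∈ v∉
      ... | no _ | yes a~v | _ = contradiction a~v a≁v
      ... | no _ | no _ | yes c~v = contradiction c~v c≁v
      ... | no _ | no _ | no _ = refl

      lab-edge : ∀ {v w} → v ∉ R → w ∉ R → AdjG G v w → lab v ≡ lab w
      lab-edge {v} {w} v∉ w∉ e = go (a ~? v) (c ~? v)
        where
        go : Dec (a ~ v) → Dec (c ~ v) → lab v ≡ lab w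
        go (yes a~v) _ = trans (lab-A a~v) (sym (lab-A (walk-trans a~v (step e (inR w∉) here))))
        go _ (yes c~v) = trans (lab-C c~v) (sym (lab-C (walk-trans c~v (step e (inR w∉) here))))
        go (no a≁v) (no c≁v) = trans (lab-D v∉ a≁v c≁v) (sym (lab-D w∉
          (λ a~w → a≁v (walk-trans a~w (step (adjG-sym e) (inR v∉) here)))
          (λ c~w → c≁v (walk-trans c~w (step (adjG-sym e) (inR v∉) here)))))

      lab≢R : ∀ {v} → v ∉ R → lab v ≢ 𝐑
      lab≢R {v} v∉ eq = go (a ~? v) (c ~? v)
        where
        go : Dec (a ~ v) → Dec (c ~ v) → ⊥
        go (yes a~v) _ = case trans (sym eq) (lab-A a~v) of λ ()
        go _ (yes c~v) = case trans (sym eq) (lab-C c~v) of λ ()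
        go (no a≁v) (no c≁v) = case trans (sym eq) (lab-D v∉ a≁v c≁v) of λ ()

      record Crossing (r : Fin n) : Set where
        field
          toA toC : Fin d
          toA-vert : vert toA ≡ r
          toC-vert : vert toC ≡ r
          toA-head : a ~ head G toA
          toC-head : c ~ head G toC
          in-R : r ∈ R

      crossing : ∀ {r} → r ∈ R → Crossing r
      crossing r∈ = let x , vx , a~x , _ = touches a∉ r∈
                        y , vy , c~y , _ = touches c∉ r∈
                    in record { toA = x ; toC = y ; toA-vert = vx ; toC-vert = vy
                              ; toA-head = a~x ; toC-head = c~y ; in-R = r∈ }

      module _ {r₁ r₂ : Fin n} (r₁≢r₂ : r₁ ≢ r₂) (X₁ : Crossing r₁) (X₂ : Crossing r₂) where
        open Crossing

        open Theta G connected lab (toA X₁) (toC X₁) (toA X₂) (toC X₂)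
          (trans (toA-vert X₁) (sym (toC-vert X₁))) (trans (toA-vert X₂) (sym (toC-vert X₂)))
          (λ eq → r₁≢r₂ (trans (sym (toC-vert X₁)) (trans eq (toA-vert X₂))))
          (lab-R (subst (_∈ R) (sym (toC-vert X₁)) (in-R X₁)))
          (lab-R (subst (_∈ R) (sym (toA-vert X₂)) (in-R X₂)))
          (lab-A (toA-head X₁)) (lab-A (toA-head X₂)) (lab-C (toC-head X₁)) (lab-C (toC-head X₂))
          using (Within; theta)

        within-walk : ∀ k {v t} → v ∉ R → v ~ t → Within k t → ∃[ j ] Within j v
        within-walk k v∉ here w = k , w
        within-walk k v∉ (step (x , refl , refl) (_ , w∉) p) w =
          let j , w′ = within-walk k w∉ p w
          in suc j , x , refl , inj₁ (lab-edge v∉ w∉ (x , refl , refl) , lab≢R v∉) , w′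

        -- A cut vertex steps into 𝐀; vertices of 𝐀 and 𝐂 walk to the root inside their component; a
        -- vertex of 𝐃 walks to a neighbour of `r₁`, from where one more edge reaches a root.
        reach : ∀ v → ∃[ k ] Within k v
        reach v with v Subset.∈? R
        ... | yes v∈ = let x , vx , a~x , x∉ = touches a∉ v∈
                           j , w = within-walk 0 x∉ (walk-trans (~-sym a∉ a~x) (toA-head X₁))
                                     (inj₂ (inj₂ (inj₁ refl)))
                       in suc j , x , vx , inj₂ (inj₂ (lab-R v∈ , lab-A a~x)) , w
        ... | no v∉ with a ~? v | c ~? v
        ...   | yes a~v | _ = within-walk 0 v∉ (walk-trans (~-sym a∉ a~v) (toA-head X₁))
                                (inj₂ (inj₂ (inj₁ refl)))
        ...   | no _ | yes c~v = within-walk 0 v∉ (walk-trans (~-sym c∉ c~v) (toC-head X₂))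
                                (inj₂ (inj₂ (inj₂ refl)))
        ...   | no a≁v | no c≁v =
          let x , vx , v~x , x∉ = touches v∉ (in-R X₁)
              vααx : vert (α (α x)) ≡ r₁
              vααx = trans (cong vert (α-invol x)) vx
              lab-x : lab (head G x) ≡ 𝐃
              lab-x = lab-D x∉ (λ a~x → a≁v (walk-trans a~x (~-sym v∉ v~x)))
                               (λ c~x → c≁v (walk-trans c~x (~-sym v∉ v~x)))
          in within-walk 1 v∉ v~x
               (α x , refl , inj₂ (inj₁ (lab-x , trans (cong lab vααx) (lab-R (in-R X₁))))
                    , inj₁ (trans vααx (sym (toC-vert X₁))))

        opposite : ∀ {x₁ x₂} → Linked G lab x₁ x₂ →
          ¬ (Arc G (toA X₁) (toC X₁) (toA X₁) x₁ × Arc G (toA X₂) (toC X₂) (toA X₂) x₂) ×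
          ¬ (Arc G (toA X₁) (toC X₁) (toC X₁) x₁ × Arc G (toA X₂) (toC X₂) (toC X₂) x₂)
        opposite = theta reach

      -- At each rᵢ the dart xᵢ lies on one of the two arcs between the darts to 𝐀
      -- and 𝐂; two of the three lie on the same one.
      no-three : (x₁ x₂ x₃ : Fin d) → vert x₁ ∈ R → vert x₂ ∈ R → vert x₃ ∈ R →
        vert x₁ ≢ vert x₂ → vert x₁ ≢ vert x₃ → vert x₂ ≢ vert x₃ →
        Linked G lab x₁ x₂ → Linked G lab x₁ x₃ → ¬ Linked G lab x₂ x₃
      no-three x₁ x₂ x₃ r₁∈ r₂∈ r₃∈ r₁≢r₂ r₁≢r₃ r₂≢r₃ l₁₂ l₁₃ l₂₃ =
        pigeon (turn X₁) (turn X₂) (turn X₃)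
        where
        open Crossing
        X₁ : Crossing (vert x₁)
        X₁ = crossing r₁∈
        X₂ : Crossing (vert x₂)
        X₂ = crossing r₂∈
        X₃ : Crossing (vert x₃)
        X₃ = crossing r₃∈
        FromA FromC : ∀ {x} → Crossing (vert x) → Set
        FromA {x} X = Arc G (toA X) (toC X) (toA X) x
        FromC {x} X = Arc G (toA X) (toC X) (toC X) x
        turn : ∀ {x} (X : Crossing (vert x)) → FromA X ⊎ FromC X
        turn X = arc-from G (toA-vert X)
        pigeon : FromA X₁ ⊎ FromC X₁ → FromA X₂ ⊎ FromC X₂ → FromA X₃ ⊎ FromC X₃ → ⊥
        pigeon (inj₁ p) (inj₁ q) _ = proj₁ (opposite r₁≢r₂ X₁ X₂ l₁₂) (p , q)
        pigeon (inj₂ p) (inj₂ q) _ = proj₂ (opposite r₁≢r₂ X₁ X₂ l₁₂) (p , q)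
        pigeon (inj₁ p) (inj₂ _) (inj₁ q) = proj₁ (opposite r₁≢r₃ X₁ X₃ l₁₃) (p , q)
        pigeon (inj₁ _) (inj₂ p) (inj₂ q) = proj₂ (opposite r₂≢r₃ X₂ X₃ l₂₃) (p , q)
        pigeon (inj₂ _) (inj₁ p) (inj₁ q) = proj₁ (opposite r₂≢r₃ X₂ X₃ l₂₃) (p , q)
        pigeon (inj₂ p) (inj₁ _) (inj₂ q) = proj₂ (opposite r₁≢r₃ X₁ X₃ l₁₃) (p , q)

    -- A third component touches three cut vertices. A colouring as in `Linked` is constant around
    -- it, so the darts from these vertices into it are pairwise linked, against `no-three`.
    at-most-two-components : ∀ {a c b} → a ∉ R → c ∉ R → b ∉ R →
      ¬ (a ~ c) → ¬ (a ~ b) → ¬ ¬ (c ~ b)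
    at-most-two-components {a} {c} {b} a∉ c∉ b∉ a≁c a≁b c≁b =
      let r₁ , r₂ , r₃ , (r₁∈ , r₂∈ , r₃∈) , (r₁≢r₂ , r₁≢r₃ , r₂≢r₃) = three-elements R three-in-R
          x₁ , v₁ , b~₁ , _ = touches b∉ r₁∈
          x₂ , v₂ , b~₂ , _ = touches b∉ r₂∈
          x₃ , v₃ , b~₃ , _ = touches b∉ r₃∈
      in no-three x₁ x₂ x₃ (subst (_∈ R) (sym v₁) r₁∈) (subst (_∈ R) (sym v₂) r₂∈)
           (subst (_∈ R) (sym v₃) r₃∈)
           (λ eq → r₁≢r₂ (trans (sym v₁) (trans eq v₂)))
           (λ eq → r₁≢r₃ (trans (sym v₁) (trans eq v₃)))
           (λ eq → r₂≢r₃ (trans (sym v₂) (trans eq v₃)))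
           (linked (v∈R v₁ r₁∈) (v∈R v₂ r₂∈) b~₁ b~₂) (linked (v∈R v₁ r₁∈) (v∈R v₃ r₃∈) b~₁ b~₃)
           (linked (v∈R v₂ r₂∈) (v∈R v₃ r₃∈) b~₂ b~₃)
      where
      open TwoSides a c a∉ c∉ a≁c
      v∈R : ∀ {x r} → vert x ≡ r → r ∈ R → vert x ∈ R
      v∈R eq r∈ = subst (_∈ R) (sym eq) r∈
      InB : Fin n → Set
      InB v = InR v × b ~ v
      b-outer : ∀ {v} → b ~ v → Outer (lab v)
      b-outer b~v = inj₂ (lab-D (~-end b∉ b~v) (λ a~v → a≁b (walk-trans a~v (~-sym b∉ b~v)))
                                               (λ c~v → c≁b (walk-trans c~v (~-sym b∉ b~v))))
      next-outer : ∀ x → b ~ vert x → Outer (lab (head G x))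
      next-outer x b~x = case head G x Subset.∈? R of λ
        { (yes h∈) → inj₁ (lab-R h∈)
        ; (no h∉)  → b-outer (walk-trans b~x (step (x , refl , refl) (inR h∉) here)) }
      linked : ∀ {x y} → vert x ∈ R → vert y ∈ R → b ~ head G x → b ~ head G y → Linked G lab x y
      linked {x} {y} x∈ y∈ b~x b~y g g-φ flat = begin
        g x     ≡⟨ flat x (inj₁ (lab-R x∈)) (b-outer b~x) ⟩
        g (α x) ≡⟨ constant-along G g g-φ InB (λ z (_ , b~z) → flat z (b-outer b~z) (next-outer z b~z))
                     (inR (~-end b∉ b~x) , b~x)
                     (walk-history b~x (walk-trans (~-sym b∉ b~x) b~y)) (α x) (α y) refl refl ⟩
        g (α y) ≡⟨ flat y (inj₁ (lab-R y∈)) (b-outer b~y) ⟨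
        g y     ∎
        where open ≡-Reasoning

    -- The face takes the place of a third component: its darts are linked because colours are
    -- constant on faces.
    face-escapes : ∀ x → vert x ∈ R → vert (φ x) ∈ R → ¬ (vert (φ (φ x)) ∈ R)
    face-escapes x x₀∈ x₁∈ x₂∈ with split
    ... | a , c , a∉ , c∉ , a≁c =
      no-three x (φ x) (φ (φ x)) x₀∈ x₁∈ x₂∈ (consecutive x) x₀≢x₂ (consecutive (φ x))
        (λ g g-φ _ → sym (g-φ x))
        (λ g g-φ _ → sym (trans (g-φ (φ x)) (g-φ x)))
        (λ g g-φ _ → sym (g-φ (φ x)))
      where
      open TwoSides a c a∉ c∉ a≁c
      open Crossing
      consecutive : ∀ y → vert y ≢ vert (φ y)
      consecutive y eq = no-loop y (sym (trans eq (vert-σ (α y))))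
      X : Crossing (vert (φ x))
      X = crossing x₁∈
      -- Otherwise φ x = α x, so that this dart is alone at its vertex.
      x₀≢x₂ : vert x ≢ vert (φ (φ x))
      x₀≢x₂ eq = a≁c (walk-trans (toA-head X)
          (subst (λ y → head G y ~ c) (trans (alone (toC-vert X)) (sym (alone (toA-vert X))))
            (~-sym c∉ (toC-head X))))
        where
        back : α x ≡ φ x
        back = no-multi (α x) (φ x) (sym (vert-σ (α x)))
          (trans (cong vert (α-invol x)) (trans eq (vert-σ (α (φ x)))))
        alone : ∀ {y} → vert y ≡ vert (φ x) → y ≡ α x
        alone {y} vy with σ-cyclic (α x) y (trans (sym (vert-σ (α x))) (sym vy))
        ... | k , refl = go k
          where
          go : ∀ k → iter σ k (α x) ≡ α x
          go zero = refl
          go (suc k) = trans (cong σ (go k)) (sym back)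

-- Subsets of a disjoint union.

module _ {m k : ℕ} (p : Subset m) (q : Subset k) where

  ∈-++ˡ⁺ : ∀ {i} → i ∈ p → i ↑ˡ k ∈ p ++ q
  ∈-++ˡ⁺ {i} i∈ = lookup⇒[]= _ (p ++ q) (trans (lookup-++ˡ p q i) ([]=⇒lookup i∈))

  ∈-++ˡ⁻ : ∀ {i} → i ↑ˡ k ∈ p ++ q → i ∈ p
  ∈-++ˡ⁻ {i} i∈ = lookup⇒[]= i p (trans (sym (lookup-++ˡ p q i)) ([]=⇒lookup i∈))

  ∈-++ʳ⁺ : ∀ {i} → i ∈ q → m ↑ʳ i ∈ p ++ q
  ∈-++ʳ⁺ {i} i∈ = lookup⇒[]= _ (p ++ q) (trans (lookup-++ʳ p q i) ([]=⇒lookup i∈))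

  ∈-++ʳ⁻ : ∀ {i} → m ↑ʳ i ∈ p ++ q → i ∈ q
  ∈-++ʳ⁻ {i} i∈ = lookup⇒[]= i q (trans (sym (lookup-++ʳ p q i)) ([]=⇒lookup i∈))

module _ {m : ℕ} {P : Fin m → Set} (P? : ∀ i → Dec (P i)) where

  comprehension : Subset m
  comprehension = tabulate (does ∘ P?)

  ∈-comprehension⁺ : ∀ {i} → P i → i ∈ comprehension
  ∈-comprehension⁺ {i} Pi = lookup⇒[]= i _ (trans (lookup∘tabulate _ i) (dec-true (P? i) Pi))

  ∈-comprehension⁻ : ∀ {i} → i ∈ comprehension → P i
  ∈-comprehension⁻ {i} i∈ with P? i | trans (sym (lookup∘tabulate (does ∘ P?) i)) ([]=⇒lookup i∈)
  ... | yes Pi | _ = Pi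
  ... | no _ | ()

data View (n d : ℕ) : Fin (n + d) → Set where
  old : ∀ u → View n d (u ↑ˡ d)
  new : ∀ x → View n d (n ↑ʳ x)

view : ∀ n {d} i → View n d i
view n {d} i with splitAt n i in eq
... | inj₁ u = subst (View n d) (Fin.splitAt⁻¹-↑ˡ eq) (old u)
... | inj₂ x = subst (View n d) (Fin.splitAt⁻¹-↑ʳ eq) (new x)

-- Vertices and edges of G^∇.

module _ (G : PlaneGraph) where
  open PlaneGraph G

  private
    ∇ : Graph
    ∇ = nabla G
    o : Fin n → Fin (n + d)
    o = _↑ˡ d
    w : Fin d → Fin (n + d)
    w = n ↑ʳ_

  adj-oo : ∀ u v → Graph.Adj ∇ (o u) (o v) ≡ AdjG G u v
  adj-oo u v = cong₂ (nablaAdj' G) (Fin.splitAt-↑ˡ n u d) (Fin.splitAt-↑ˡ n v d)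

  adj-ow : ∀ u x → Graph.Adj ∇ (o u) (w x) ≡ OnFace G u x
  adj-ow u x = cong₂ (nablaAdj' G) (Fin.splitAt-↑ˡ n u d) (Fin.splitAt-↑ʳ n d x)

  adj-wo : ∀ u x → Graph.Adj ∇ (w x) (o u) ≡ OnFace G u x
  adj-wo u x = cong₂ (nablaAdj' G) (Fin.splitAt-↑ʳ n d x) (Fin.splitAt-↑ˡ n u d)

  adj∇-sym : ∀ {i j} → Graph.Adj ∇ i j → Graph.Adj ∇ j i
  adj∇-sym {i} {j} = go (splitAt n i) (splitAt n j)
    where
    go : ∀ s t → nablaAdj' G s t → nablaAdj' G t s
    go (inj₁ _) (inj₁ _) e = adjG-sym G e
    go (inj₁ _) (inj₂ _) e = e
    go (inj₂ _) (inj₁ _) e = e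

  large : Fin d → Bool
  large x = does (isOrbitRep? φ x) ∧ isLarge G x

  -- The characteristic function is local to `nablaV`; the existential gives access to it.
  nablaV-bits : ∃[ f ] nablaV G ≡ tabulate f
  nablaV-bits = _ , refl

  nablaV-o : ∀ u → proj₁ nablaV-bits (o u) ≡ true
  nablaV-o u rewrite Fin.splitAt-↑ˡ n u d = refl

  nablaV-w : ∀ x → proj₁ nablaV-bits (w x) ≡ large x
  nablaV-w x rewrite Fin.splitAt-↑ʳ n d x with large x
  ... | true  = refl
  ... | false = refl

  lookup-o : ∀ u → lookup (nablaV G) (o u) ≡ true
  lookup-o u = trans (lookup∘tabulate (proj₁ nablaV-bits) (o u)) (nablaV-o u)

  lookup-w : ∀ x → lookup (nablaV G) (w x) ≡ large x
  lookup-w x = trans (lookup∘tabulate (proj₁ nablaV-bits) (w x)) (nablaV-w x)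

  o∈V : ∀ u → o u ∈ nablaV G
  o∈V u = lookup⇒[]= (o u) (nablaV G) (lookup-o u)

  w∈V⁺ : ∀ {x} → large x ≡ true → w x ∈ nablaV G
  w∈V⁺ {x} eq = lookup⇒[]= (w x) (nablaV G) (trans (lookup-w x) eq)

  w∈V⁻ : ∀ {x} → w x ∈ nablaV G → large x ≡ true
  w∈V⁻ {x} x∈ = trans (sym (lookup-w x)) ([]=⇒lookup x∈)

  -- The minimal cut of G^∇ with trace R.

  module _ (three-connected : KConnected (graphOf G) 3) (R : Subset n)
           (R-min : IsMinimalCut (graphOf G) R) where
    open Cut G three-connected R R-min

    -- Iterates below `d` already cover the face, and the finite range makes the relation decidable.
    Touches : Fin n → Fin d → Set
    Touches s x = ∃[ k ] s ~ vert (iter φ (toℕ {d} k) x)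

    touches⁺ : ∀ {s v x} → s ~ v → OnFace G v x → Touches s x
    touches⁺ {s} {x = x} s~v (k , refl) =
      let j , j<d , eq = iter-reduce (φ-injective G) x k
      in fromℕ< j<d , subst (s ~_) (cong vert (trans (sym eq)
           (cong (λ i → iter φ i x) (sym (Fin.toℕ-fromℕ< j<d))))) s~v

    touches⁻ : ∀ {s x} → Touches s x → ∃[ v ] s ~ v × OnFace G v x
    touches⁻ (k , s~v) = _ , s~v , toℕ k , refl

    face-touches-outside : ∀ x → ∃[ v ] v ∉ R × OnFace G v x
    face-touches-outside x with vert x Subset.∈? R | vert (φ x) Subset.∈? R
    ... | no v∉ | _ = _ , v∉ , 0 , refl
    ... | yes _ | no v∉ = _ , v∉ , 1 , refl
    ... | yes x₀∈ | yes x₁∈ = _ , face-escapes x x₀∈ x₁∈ , 2 , refl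

    module Sides (a c : Fin n) (a∉ : a ∉ R) (c∉ : c ∉ R) (a≁c : ¬ (a ~ c)) where

      cover : ∀ {v} → v ∉ R → a ~ v ⊎ c ~ v
      cover {v} v∉ with a ~? v | c ~? v
      ... | yes a~v | _      = inj₁ a~v
      ... | no _    | yes c~v = inj₂ c~v
      ... | no a≁v  | no c≁v  = ⊥-elim (at-most-two-components a∉ c∉ v∉ a≁c a≁v c≁v)

      module _ (T : Subset (n + d)) (T-old : ∀ {u} → o u ∈ T → u ∈ R) where

        Out : Fin (n + d) → Set
        Out = InMinus ∇ T

        out-o : ∀ {u} → u ∉ R → Out (o u)
        out-o u∉ = o∈V _ , u∉ ∘ T-old

        step-oo : ∀ {u v} → AdjG G u v → Out (o v) → Walk ∇ Out (o u) (o v)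
        step-oo e out = step (subst id (sym (adj-oo _ _)) e) out here

        step-ow : ∀ {u x} → OnFace G u x → Out (w x) → Walk ∇ Out (o u) (w x)
        step-ow e out = step (subst id (sym (adj-ow _ _)) e) out here

        step-wo : ∀ {u x} → OnFace G u x → Out (o u) → Walk ∇ Out (w x) (o u)
        step-wo e out = step (subst id (sym (adj-wo _ _)) e) out here

        lift : ∀ {u v} → u ~ v → Walk ∇ Out (o u) (o v)
        lift here = here
        lift (step e (_ , v∉) p) = walk-trans (step-oo e (out-o v∉)) (lift p)

        -- Every remaining cut vertex has a neighbour in the component of `a`, and every face has a
        -- vertex outside R, which lies on one of the two sides.
        reachable : ∀ i → Out i → Walk ∇ Out (o a) i ⊎ Walk ∇ Out (o c) i
        reachable i = go (view n i)
          where
          extend : ∀ {v j} → v ∉ R → Walk ∇ Out (o v) j → Walk ∇ Out (o a) j ⊎ Walk ∇ Out (o c) j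
          extend v∉ p = Sum.map (λ a~v → walk-trans (lift a~v) p) (λ c~v → walk-trans (lift c~v) p) (cover v∉)
          go : ∀ {i} → View n d i → Out i → Walk ∇ Out (o a) i ⊎ Walk ∇ Out (o c) i
          go (old v) out with v Subset.∈? R
          ... | no v∉ = extend v∉ here
          ... | yes v∈ = let x , vx , _ , x∉ = touches a∉ v∈ in
            extend x∉ (step-oo (α x , refl , trans (cong vert (α-invol x)) vx) out)
          go (new x) out = let v , v∉ , on = face-touches-outside x in extend v∉ (step-ow on out)

        joined⇒connected : Walk ∇ Out (o a) (o c) → ConnectedMinus ∇ T
        joined⇒connected ac i j i-out j-out =
          walk-trans (walk-sym adj∇-sym (out-o a∉) (from-a i i-out)) (from-a j j-out)
          where
          from-a : ∀ i → Out i → Walk ∇ Out (o a) i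
          from-a i out = [ id , walk-trans ac ]′ (reachable i out)

        through-old : ∀ {r} → r ∈ R → Out (o r) → Walk ∇ Out (o a) (o c)
        through-old r∈ out =
          let x , vx , a~x , x∉ = touches a∉ r∈
              y , vy , c~y , y∉ = touches c∉ r∈
          in walk-trans (lift a~x) (walk-trans
               (step-oo (α x , refl , trans (cong vert (α-invol x)) vx) out)
               (walk-trans (step-oo (y , vy , refl) (out-o y∉)) (lift (~-sym c∉ c~y))))

        through-new : ∀ {x} → Touches a x → Touches c x → Out (w x) → Walk ∇ Out (o a) (o c)
        through-new ta tc out =
          let u , a~u , on-u = touches⁻ ta
              v , c~v , on-v = touches⁻ tc
          in walk-trans (lift a~u) (walk-trans (step-ow on-u out)
               (walk-trans (step-wo on-v (out-o (~-end c∉ c~v))) (lift (~-sym c∉ c~v))))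

      -- Otherwise every neighbour of `w x` left by the cut lies on the side of `c`. A walk from `a`
      -- then cannot enter `w x`, so restoring this vertex would not join `a` to `c`, against
      -- minimality.
      forced : ∀ X → (∀ U → U ⊂ R ++ X → ConnectedMinus ∇ U) →
        ¬ Walk ∇ (InMinus ∇ (R ++ X)) (o a) (o c) → ∀ {x} → x ∈ X → Touches a x
      forced X T-min apart {x} x∈X = case touch? of λ
        { (yes t) → t
        ; (no ¬t) → ⊥-elim (apart (avoid ¬t (out-o T T-old a∉) here
            (T-min (T - w x) (Subset.x∈p⇒p-x⊂p (∈-++ʳ⁺ R X x∈X)) (o a) (o c) (less a∉) (less c∉)))) }
        where
        T : Subset (n + d)
        T = R ++ X
        T-old : ∀ {u} → o u ∈ T → u ∈ R
        T-old = ∈-++ˡ⁻ R X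
        touch? : Dec (Touches a x)
        touch? = Fin.any? λ k → a ~? vert (iter φ (toℕ k) x)
        less : ∀ {u} → u ∉ R → InMinus ∇ (T - w x) (o u)
        less u∉ = o∈V _ , u∉ ∘ T-old ∘ proj₁ ∘ ∈-remove
        W : Fin (n + d) → Fin (n + d) → Set
        W = Walk ∇ (InMinus ∇ T)
        blocked : ¬ Touches a x → ∀ {i} → View n d i → InMinus ∇ T i → W (o a) i →
          ¬ Graph.Adj ∇ i (w x)
        blocked ¬t (new y) _ _ e = subst id (cong₂ (nablaAdj' G) (Fin.splitAt-↑ʳ n d y) (Fin.splitAt-↑ʳ n d x)) e
        blocked ¬t (old v) (_ , v∉T) p e with v Subset.∈? R
        ... | no v∉ = [ (λ a~v → ¬t (touches⁺ a~v (subst id (adj-ow v x) e)))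
                      , (λ c~v → apart (walk-trans p (walk-sym adj∇-sym (out-o T T-old c∉) (lift T T-old c~v))))
                      ]′ (cover v∉)
        ... | yes v∈ = contradiction (∈-++ˡ⁺ R X v∈) v∉T
        avoid : ¬ Touches a x → ∀ {i j} → InMinus ∇ T i → W (o a) i →
          Walk ∇ (InMinus ∇ (T - w x)) i j → W (o a) j
        avoid ¬t _ p here = p
        avoid ¬t {i} i-out p (step {w = k} e (k∈ , k∉) q) with k ≟ w x
        ... | yes refl = contradiction e (blocked ¬t (view n i) i-out p)
        ... | no k≢x = avoid ¬t k-out (walk-trans p (step e k-out here)) q
          where
          k-out : InMinus ∇ T k
          k-out = k∈ , λ k∈T → k∉ (Subset.x∈p∧x≢y⇒x∈p-y k∈T k≢x)

      Separating : Fin d → Set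
      Separating x = large x ≡ true × Touches a x × Touches c x

      separating? : ∀ x → Dec (Separating x)
      separating? x = (large x 𝔹.≟ true) ×-dec
        Fin.any? (λ k → a ~? vert (iter φ (toℕ k) x)) ×-dec
        Fin.any? (λ k → c ~? vert (iter φ (toℕ k) x))

      F : Subset d
      F = comprehension separating?

      -- `Side` is preserved by walks from `a` that avoid `R ++ F`; `Outside` spells out this
      -- avoidance for the two kinds of vertices.
      Side Outside : Fin n ⊎ Fin d → Set
      Side = [ a ~_ , Touches a ]′
      Outside (inj₁ v) = v ∉ R
      Outside (inj₂ x) = ¬ Separating x × large x ≡ true

      classify : ∀ {i} → InMinus ∇ (R ++ F) i → Outside (splitAt n i)
      classify {i} = go (view n i)
        where
        go : ∀ {i} → View n d i → InMinus ∇ (R ++ F) i → Outside (splitAt n i)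
        go (old v) (_ , v∉) rewrite Fin.splitAt-↑ˡ n v d = v∉ ∘ ∈-++ˡ⁺ R F
        go (new x) (x∈ , x∉) rewrite Fin.splitAt-↑ʳ n d x =
          x∉ ∘ ∈-++ʳ⁺ R F ∘ ∈-comprehension⁺ separating? , w∈V⁻ x∈

      side-step : ∀ s t → nablaAdj' G s t → Outside s → Outside t → Side s → Side t
      side-step (inj₁ u) (inj₁ v) e _ v∉ a~u = walk-trans a~u (step e (inR v∉) here)
      side-step (inj₁ u) (inj₂ x) on _ _ a~u = touches⁺ a~u on
      -- A large face touching `a` that led to the side of `c` would be separating, hence deleted.
      side-step (inj₂ x) (inj₁ v) on (¬sep , big) v∉ t =
        [ id , (λ c~v → contradiction (big , t , touches⁺ c~v on) ¬sep) ]′ (cover v∉)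

      F-old : ∀ {u} → o u ∈ R ++ F → u ∈ R
      F-old = ∈-++ˡ⁻ R F

      F-separates : ¬ Walk ∇ (InMinus ∇ (R ++ F)) (o a) (o c)
      F-separates p = a≁c (subst Side (Fin.splitAt-↑ˡ n c d)
        (go p (out-o (R ++ F) F-old a∉) (subst Side (sym (Fin.splitAt-↑ˡ n a d)) here)))
        where
        go : ∀ {i j} → Walk ∇ (InMinus ∇ (R ++ F)) i j → InMinus ∇ (R ++ F) i →
          Side (splitAt n i) → Side (splitAt n j)
        go here _ side = side
        go (step {u = i} {w = k} e out p) i-out side = go p out
          (side-step (splitAt n i) (splitAt n k) e (classify i-out) (classify out) side)

      -- Any element left out, be it a cut vertex or the vertex of a separating face, joins `a` to
      -- `c` on its own.
      F-minimal : ∀ T → T ⊂ R ++ F → ConnectedMinus ∇ T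
      F-minimal T (T⊆ , s , s∈ , s∉) = joined⇒connected T T-old (go (view n s) s∈ s∉)
        where
        T-old : ∀ {u} → o u ∈ T → u ∈ R
        T-old = F-old ∘ T⊆
        go : ∀ {s} → View n d s → s ∈ R ++ F → s ∉ T → Walk ∇ (InMinus ∇ T) (o a) (o c)
        go (old r) r∈ r∉ = through-old T T-old (F-old r∈) (o∈V r , r∉)
        go (new x) x∈ x∉ =
          let big , ta , tc = ∈-comprehension⁻ separating? (∈-++ʳ⁻ R F x∈)
          in through-new T T-old ta tc (w∈V⁺ big , x∉)

      F-cut : IsMinimalCut ∇ (R ++ F)
      F-cut = (⊆V , λ conn → F-separates (conn (o a) (o c) (out a∉) (out c∉))) , F-minimal
        where
        out : ∀ {u} → u ∉ R → InMinus ∇ (R ++ F) (o u)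
        out = out-o (R ++ F) F-old
        ⊆V : R ++ F ⊆ nablaV G
        ⊆V {i} = go (view n i)
          where
          go : ∀ {i} → View n d i → i ∈ R ++ F → i ∈ nablaV G
          go (old u) _ = o∈V u
          go (new x) x∈ = w∈V⁺ (proj₁ (∈-comprehension⁻ separating? (∈-++ʳ⁻ R F x∈)))

    module _ {a c : Fin n} (a∉ : a ∉ R) (c∉ : c ∉ R) (a≁c : ¬ (a ~ c)) where
      open Sides a c a∉ c∉ a≁c
      -- `forced` concerns the side of `a`; exchanging `a` and `c` yields the other side.
      private module Swapped = Sides c a c∉ a∉ (a≁c ∘ ~-sym c∉)

      -- Minimality makes each face in the cut touch both sides, and a separating face left out
      -- would join `a` to `c`.
      F-unique : ∀ X → IsMinimalCut ∇ (R ++ X) → X ≡ F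
      F-unique X ((⊆V , disconnected) , minimal) = Subset.⊆-antisym X⊆F F⊆X
        where
        T-old : ∀ {u} → o u ∈ R ++ X → u ∈ R
        T-old = ∈-++ˡ⁻ R X
        apart : ¬ Walk ∇ (InMinus ∇ (R ++ X)) (o a) (o c)
        apart p = disconnected (joined⇒connected (R ++ X) T-old p)
        X⊆F : X ⊆ F
        X⊆F x∈ = ∈-comprehension⁺ separating?
          ( w∈V⁻ (⊆V (∈-++ʳ⁺ R X x∈))
          , forced X minimal apart x∈
          , Swapped.forced X minimal
              (apart ∘ walk-sym adj∇-sym (out-o (R ++ X) T-old c∉)) x∈)
        F⊆X : F ⊆ X
        F⊆X {x} x∈ = decidable-stable (x Subset.∈? X) λ x∉ →
          let big , ta , tc = ∈-comprehension⁻ separating? x∈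
          in apart (through-new (R ++ X) T-old ta tc (w∈V⁺ big , x∉ ∘ ∈-++ʳ⁻ R X))

theorem19 : (G : PlaneGraph) → KConnected (graphOf G) 3 →
    (R : Subset (PlaneGraph.n G)) → IsMinimalCut (graphOf G) R →
    ∃[ S ] ((IsMinimalCut (nabla G) S × take (PlaneGraph.n G) S ≡ R)
    × (∀ S′ → IsMinimalCut (nabla G) S′ → take (PlaneGraph.n G) S′ ≡ R → S′ ≡ S))
theorem19 G three-connected R R-min =
  let a , c , a∉ , c∉ , a≁c = Cut.split G three-connected R R-min
      open Sides G three-connected R R-min a c a∉ c∉ a≁c
  in R ++ F
   , (F-cut , ++-injectiveˡ _ R (take++drop≡id n (R ++ F)))
   -- Once its trace is `R`, `S′` is determined by its face part `drop n S′`.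
   , λ { S′ S′-min refl →
         let S′≡ = take++drop≡id n S′ in
         trans (sym S′≡) (cong (R ++_) (F-unique G three-connected R R-min a∉ c∉ a≁c (drop n S′)
           (subst (IsMinimalCut (nabla G)) (sym S′≡) S′-min))) }
  where open PlaneGraph G
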